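{- Let $p\geq 5$ be a prime number and $n$ a positive integer. Then $$\binom{np-1}{p-1}_{2}\equiv \begin{cases} 1+npq_{3} \pmod{p^{2}} & \text{if } p\equiv 1 \pmod 3,\\ -1-npq_{3} \pmod{p^{2}} & \text{if } p\equiv 2 \pmod 3,\end{cases}$$ and $$\binom{np-1}{\frac{p-1}{2}}_{2}\equiv \begin{cases} 1+np\left(2q_{2}+\tfrac{1}{2}q_{3}\right) \pmod{p^{2}} & \text{if } p\equiv 1 \pmod 6,\\ -\tfrac{1}{2}npq_{3} \pmod{p^{2}} & \text{if } p\equiv 5 \pmod 6.\end{cases}$$
   Context: For a nonnegative integer $m$, the trinomial coefficients $\binom{m}{k}_2$ are defined by $(1+x+x^2)^m=\sum_{k=0}^{2m}\binom{m}{k}_2x^k$. For a prime $p$ and an integer $a$ not divisible by $p$, the Fermat quotient is $q_a=(a^{p-1}-1)/p$. Congruences involving rational numbers are understood for rationals whose denominators are coprime to $p$ (i.e. in the ring of $p$-integral rationals). -}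

module Defs where

open import Data.Nat as ℕ using (ℕ; zero; suc; _∸_; _^_)
open import Data.Nat.Divisibility using (_∣_)
open import Data.Integer as ℤ using (ℤ; +_)
open import Data.Rational as ℚ using (ℚ; _/_; ↧ₙ_)
open import Data.List using (List; []; _∷_)
open import Data.Product using (Σ; _×_)
open import Relation.Nullary using (¬_)
open import Relation.Binary.PropositionalEquality using (_≡_)

-- Polynomials with natural-number coefficients as coefficient lists
-- (constant term first).
Poly : Set
Poly = List ℕ

coeff : Poly → ℕ → ℕ
coeff []       _       = 0
coeff (a ∷ _)  zero    = a
coeff (_ ∷ as) (suc k) = coeff as k

addP : Poly → Poly → Poly
addP []       bs       = bs
addP as       []       = as
addP (a ∷ as) (b ∷ bs) = (a ℕ.+ b) ∷ addP as bs

scaleP : ℕ → Poly → Poly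
scaleP c []       = []
scaleP c (b ∷ bs) = (c ℕ.* b) ∷ scaleP c bs

mulP : Poly → Poly → Poly
mulP []       bs = []
mulP (a ∷ as) bs = addP (scaleP a bs) (0 ∷ mulP as bs)

powP : Poly → ℕ → Poly
powP f zero    = 1 ∷ []
powP f (suc m) = mulP f (powP f m)

trinom : Poly
trinom = 1 ∷ 1 ∷ 1 ∷ []

trinomialCoeff : ℕ → ℕ → ℕ
trinomialCoeff m k = coeff (powP trinom m) k

ℕ→ℚ : ℕ → ℚ
ℕ→ℚ n = + n / 1

-- Fermat quotient q_a = (a^(p-1) - 1) / p  (as a rational; p = 0 gives 0,
-- irrelevant since p will be prime)
fermatQuotient : ℕ → ℕ → ℚ
fermatQuotient p@(suc _) a = ((+ (a ^ (p ∸ 1))) ℤ.- (+ 1)) / p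
fermatQuotient zero      a = ℚ.0ℚ

-- Congruence modulo m in the ring of p-integral rationals:
-- x ≡ y (mod m)  iff  x - y = m * r for some rational r whose (reduced)
-- denominator is not divisible by p.
CongMod : (p : ℕ) (m : ℕ) (x y : ℚ) → Set
CongMod p m x y = Σ ℚ λ r → (¬ (p ∣ ↧ₙ r)) × (x ℚ.- y ≡ ℕ→ℚ m ℚ.* r)

-- Write f = 1 + x + x² and let T(m, k) be the coefficient of xᵏ in fᵐ. From f (fᵐ)′ = m (1 + 2x) fᵐ,
--   (k + 1) T(m, k + 1) = (m - k) T(m, k) + (2m - k + 1) T(m, k - 1),
-- and for m = n p - 1 this determines T(m, k) modulo p² for k < p: T(m, k) ≡ c(k) + n p h(k), where
-- c = 1, -1, 0, 1, -1, 0, … are the coefficients of 1 / f and h(k) + h(k - 1) + h(k - 2) ≡ (c(k - 1) + 2 c(k - 2)) / k.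
-- Summing over k modulo 3, and using 3b = a + j p to replace 1 / a by 1 / (3b), expresses h(k) modulo p by
-- harmonic numbers H(⌊j p / 6⌋). These satisfy H(p - 1 - k) ≡ H(k), a duplication relation from splitting H into
-- even and odd terms, and 2 q₂ ≡ - H(⌊p / 2⌋), 3 q₃ ≡ - 2 H(⌊p / 3⌋), obtained by writing (p - 1)! as a
-- product of numbers s b - j p for s = 2, 3 and expanding modulo p².
module Submission where

open import Defs

module TrinomialResidues where

  open import Data.Nat as ℕ using (ℕ; zero; suc)
  import Data.Nat.Properties as ℕ
  import Data.Nat.Divisibility as ℕ
  import Data.Nat.Tactic.RingSolver as ℕ
  open import Data.Nat.Coprimality using (Coprime; coprime-Bézout)
  open import Data.Nat.GCD using (module Bézout)
  open import Data.Nat.Primality using (Prime; euclidsLemma; prime⇒nonZero; prime⇒nonTrivial; prime⇒irreducible)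
  open import Data.Integer as ℤ using (ℤ; +_; 0ℤ; 1ℤ; _+_; _*_; _-_; -_)
  open import Data.Integer.Properties as ℤ using (pos-+; pos-*)
  open import Data.Integer.Divisibility.Signed
  open import Data.Integer.Tactic.RingSolver using (solve-∀)
  open import Data.List using ([]; _∷_)
  open import Data.Product using (∃; _×_; _,_; proj₁; proj₂)
  open import Data.Sum using (inj₁; inj₂; [_,_]′)
  open import Function using (_∘_)
  open import Relation.Nullary using (¬_; yes; no; contradiction)
  open import Relation.Binary.PropositionalEquality hiding ([_])

  -- Congruences of integers.

  infix 4 _≈_[_]
  _≈_[_] : ℤ → ℤ → ℤ → Set
  x ≈ y [ m ] = m ∣ x - y

  ≡⇒≈ : ∀ {m x y} → x ≡ y → x ≈ y [ m ]
  ≡⇒≈ {m} {x} refl = divides 0ℤ (ℤ.+-inverseʳ x)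

  infixr 7 _⊙_
  -- Congruences below are proved by displaying a difference as an integer combination of
  -- differences already known to be divisible: `⊙` scales, `⊕` adds, and `by` takes the ring
  -- identity. Exact equations enter through `≡⇒≈`.
  _⊙_ : ∀ {m d} c → m ∣ d → m ∣ c * d
  c ⊙ h = ∣n⇒∣m*n c h

  infixl 6 _⊕_
  _⊕_ : ∀ {m d e} → m ∣ d → m ∣ e → m ∣ d + e
  _⊕_ = ∣m∣n⇒∣m+n

  infix 5 _by_
  _by_ : ∀ {m d e} → m ∣ d → e ≡ d → m ∣ e
  h by eq = subst (_ ∣_) (sym eq) h

  ≈-* : ∀ {m} x y x′ y′ → x ≈ x′ [ m ] → y ≈ y′ [ m ] → x * y ≈ x′ * y′ [ m ]
  ≈-* x y x′ y′ h k = y ⊙ h ⊕ x′ ⊙ k by identity x y x′ y′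
    where
    identity : ∀ x y x′ y′ → x * y - x′ * y′ ≡ y * (x - x′) + x′ * (y - y′)
    identity = solve-∀

  pos-Bézout : ∀ x a y b → 1 ℕ.+ x ℕ.* a ≡ y ℕ.* b → 1ℤ + + x * + a ≡ + y * + b
  pos-Bézout x a y b eq = trans (cong (λ t → 1ℤ + t) (sym (pos-* x a))) (trans (cong +_ eq) (pos-* y b))

  pos-affine : ∀ s b a c → s ℕ.* b ≡ a ℕ.+ c → + s * + b ≡ + a + + c
  pos-affine s b a c eq = trans (sym (pos-* s b)) (trans (cong +_ eq) (pos-+ a c))

  Π : (ℕ → ℕ) → ℕ → ℕ
  Π f zero    = 1
  Π f (suc n) = Π f n ℕ.* f n

  Π-+ : ∀ f m n → Π f (m ℕ.+ n) ≡ Π f m ℕ.* Π (λ i → f (m ℕ.+ i)) n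
  Π-+ f m zero    rewrite ℕ.+-identityʳ m = sym (ℕ.*-identityʳ _)
  Π-+ f m (suc n) rewrite ℕ.+-suc m n = trans (cong (ℕ._* f (m ℕ.+ n)) (Π-+ f m n)) (ℕ.*-assoc (Π f m) _ _)

  -- Trinomial coefficients and their recurrence.

  coeff-addP : ∀ f g k → coeff (addP f g) k ≡ coeff f k ℕ.+ coeff g k
  coeff-addP []       g        k       = refl
  coeff-addP (a ∷ f)  []       k       = sym (ℕ.+-identityʳ _)
  coeff-addP (a ∷ f)  (b ∷ g)  zero    = refl
  coeff-addP (a ∷ f)  (b ∷ g)  (suc k) = coeff-addP f g k

  coeff-scaleP : ∀ c f k → coeff (scaleP c f) k ≡ c ℕ.* coeff f k
  coeff-scaleP c []      k       = sym (ℕ.*-zeroʳ c)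
  coeff-scaleP c (a ∷ f) zero    = refl
  coeff-scaleP c (a ∷ f) (suc k) = coeff-scaleP c f k

  -- Indices are shifted by one here and in C and h below: T m (k + 1) is the coefficient of index k, and T m 0
  -- the one of index -1.
  T : ℕ → ℕ → ℤ
  T m zero    = 0ℤ
  T m (suc k) = + trinomialCoeff m k

  -- A product `mulP trinom f` unfolds to three nested layers of this shape, so its coefficients are
  -- read off layer by layer.
  coeff-1+xf : ∀ f g k → coeff (addP (scaleP 1 f) (0 ∷ g)) (suc k) ≡ coeff f (suc k) ℕ.+ coeff g k
  coeff-1+xf f g k = trans (coeff-addP (scaleP 1 f) (0 ∷ g) (suc k))
    (cong (ℕ._+ coeff g k) (trans (coeff-scaleP 1 f (suc k)) (ℕ.*-identityˡ _)))

  coeff-1+xf-0 : ∀ f g → coeff (addP (scaleP 1 f) (0 ∷ g)) 0 ≡ coeff f 0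
  coeff-1+xf-0 f g = trans (coeff-addP (scaleP 1 f) (0 ∷ g) 0) (trans (ℕ.+-identityʳ _)
    (trans (coeff-scaleP 1 f 0) (ℕ.*-identityˡ _)))

  T-suc-1 : ∀ m → T (suc m) 1 ≡ T m 1
  T-suc-1 m = cong +_ (coeff-1+xf-0 (powP trinom m) _)

  T-suc : ∀ m k → T (suc m) (2 ℕ.+ k) ≡ T m (2 ℕ.+ k) + T m (1 ℕ.+ k) + T m k
  T-suc m zero = trans (cong +_ (trans (coeff-1+xf f _ 0) (cong (coeff f 1 ℕ.+_) (coeff-1+xf-0 f _))))
    (trans (pos-+ (coeff f 1) (coeff f 0)) (sym (ℤ.+-identityʳ _)))
    where f = powP trinom m
  T-suc m (suc k) = trans (cong +_ (trans (coeff-1+xf f _ (suc k)) (cong (coeff f (2 ℕ.+ k) ℕ.+_)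
      (trans (coeff-1+xf f _ k) (cong (coeff f (1 ℕ.+ k) ℕ.+_) (last f k))))))
    (trans (pos-+ (coeff f (2 ℕ.+ k)) _) (trans (cong (λ t → + coeff f (2 ℕ.+ k) + t) (pos-+ (coeff f (1 ℕ.+ k)) (coeff f k)))
      (sym (ℤ.+-assoc (+ coeff f (2 ℕ.+ k)) (+ coeff f (1 ℕ.+ k)) (+ coeff f k)))))
    where
    f = powP trinom m
    last : ∀ f k → coeff (addP (scaleP 1 f) (0 ∷ [])) k ≡ coeff f k
    last f zero    = coeff-1+xf-0 f []
    last f (suc k) = trans (coeff-1+xf f [] k) (ℕ.+-identityʳ _)

  -- Comparison of coefficients in f (fᵐ)′ = m (1 + 2x) fᵐ, where f = 1 + x + x².
  Recurrence : ℤ → (ℕ → ℤ) → Set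
  Recurrence m s = ∀ k → (1ℤ + + k) * s (2 ℕ.+ k) ≡ (m - + k) * s (1 ℕ.+ k) + (+ 2 * m - + k + 1ℤ) * s k

  -- Three consecutive instances of the recurrence of `s` add up to that of `t`; their leading
  -- factors differ by 1 and 2, which the extra term `y + 2 z` makes up for. For the first two
  -- indices fewer instances exist, and `s 0 ≡ 0` fills the gap.
  Recurrence-step : ∀ m s t → s 0 ≡ 0ℤ → t 0 ≡ 0ℤ → t 1 ≡ s 1 → (∀ k → t (2 ℕ.+ k) ≡ s (2 ℕ.+ k) + s (1 ℕ.+ k) + s k) →
    Recurrence m s → Recurrence (1ℤ + m) t
  Recurrence-step m s t s₀ t₀ t₁ t₂ rec zero rewrite t₂ 0 | t₁ | s₀ | t₀ =
    trans (identity (s 2) (s 1)) (trans (cong (_+ s 1) rec₀) (identity′ m (s 1)))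
    where
    rec₀ : (1ℤ + 0ℤ) * s 2 ≡ (m - 0ℤ) * s 1 + (+ 2 * m - 0ℤ + 1ℤ) * 0ℤ
    rec₀ = trans (rec 0) (cong (λ z → (m - 0ℤ) * s 1 + (+ 2 * m - 0ℤ + 1ℤ) * z) s₀)
    identity : ∀ x y → (1ℤ + 0ℤ) * (x + y + 0ℤ) ≡ (1ℤ + 0ℤ) * x + y
    identity = solve-∀
    identity′ : ∀ m y → (m - 0ℤ) * y + (+ 2 * m - 0ℤ + 1ℤ) * 0ℤ + y ≡ (1ℤ + m - 0ℤ) * y + (+ 2 * (1ℤ + m) - 0ℤ + 1ℤ) * 0ℤ
    identity′ = solve-∀
  Recurrence-step m s t s₀ t₀ t₁ t₂ rec (suc zero) rewrite t₂ 1 | t₂ 0 | t₁ | s₀ =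
    trans (identity (s 3) (s 2) (s 1)) (trans (cong₂ (λ x y → x + y + s 2 + + 2 * s 1) (rec 1) rec₀)
      (identity′ m (s 2) (s 1)))
    where
    rec₀ : (1ℤ + 0ℤ) * s 2 ≡ (m - 0ℤ) * s 1 + (+ 2 * m - 0ℤ + 1ℤ) * 0ℤ
    rec₀ = trans (rec 0) (cong (λ z → (m - 0ℤ) * s 1 + (+ 2 * m - 0ℤ + 1ℤ) * z) s₀)
    identity : ∀ x y z → (1ℤ + 1ℤ) * (x + y + z) ≡ (1ℤ + 1ℤ) * x + (1ℤ + 0ℤ) * y + y + + 2 * z
    identity = solve-∀
    identity′ : ∀ m y z → (m - 1ℤ) * y + (+ 2 * m - 1ℤ + 1ℤ) * z + ((m - 0ℤ) * z + (+ 2 * m - 0ℤ + 1ℤ) * 0ℤ) + y + + 2 * z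
      ≡ (1ℤ + m - 1ℤ) * (y + z + 0ℤ) + (+ 2 * (1ℤ + m) - 1ℤ + 1ℤ) * z
    identity′ = solve-∀
  Recurrence-step m s t s₀ t₀ t₁ t₂ rec (suc (suc k)) rewrite t₂ (2 ℕ.+ k) | t₂ (1 ℕ.+ k) | t₂ k =
    trans (identity (+ k) (s (4 ℕ.+ k)) (s (3 ℕ.+ k)) (s (2 ℕ.+ k)))
      (trans (cong (_+ (s (3 ℕ.+ k) + + 2 * s (2 ℕ.+ k))) (cong₂ _+_ (cong₂ _+_ (rec (2 ℕ.+ k)) (rec (1 ℕ.+ k))) (rec k)))
        (identity′ m (+ k) (s (3 ℕ.+ k)) (s (2 ℕ.+ k)) (s (1 ℕ.+ k)) (s k)))
    where
    identity : ∀ k x y z → (1ℤ + (+ 2 + k)) * (x + y + z) ≡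
      (1ℤ + (+ 2 + k)) * x + (1ℤ + (1ℤ + k)) * y + (1ℤ + k) * z + (y + + 2 * z)
    identity = solve-∀
    identity′ : ∀ m k y z v w →
      ((m - (+ 2 + k)) * y + (+ 2 * m - (+ 2 + k) + 1ℤ) * z) + ((m - (1ℤ + k)) * z + (+ 2 * m - (1ℤ + k) + 1ℤ) * v)
      + ((m - k) * v + (+ 2 * m - k + 1ℤ) * w) + (y + + 2 * z)
      ≡ (1ℤ + m - (+ 2 + k)) * (y + z + v) + (+ 2 * (1ℤ + m) - (+ 2 + k) + 1ℤ) * (z + v + w)
    identity′ = solve-∀

  T-recurrence : ∀ m → Recurrence (+ m) (T m)
  T-recurrence zero zero          = refl
  T-recurrence zero (suc zero)    = refl
  T-recurrence zero (suc (suc k)) = identity (+ k)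
    where
    identity : ∀ k → (1ℤ + (+ 2 + k)) * 0ℤ ≡ (0ℤ - (+ 2 + k)) * 0ℤ + (+ 2 * 0ℤ - (+ 2 + k) + 1ℤ) * 0ℤ
    identity = solve-∀
  T-recurrence (suc m) = Recurrence-step (+ m) (T m) (T (suc m)) refl refl (T-suc-1 m) (T-suc m) (T-recurrence m)

  -- The coefficients of 1 / (1 + x + x²).

  abstract

    C : ℕ → ℤ
    C zero          = 0ℤ
    C (suc zero)    = 1ℤ
    C (suc (suc k)) = - C (suc k) - C k

    C-zero : C 0 ≡ 0ℤ
    C-zero = refl

    C-one : C 1 ≡ 1ℤ
    C-one = refl

    C-suc : ∀ k → C (2 ℕ.+ k) ≡ - C (1 ℕ.+ k) - C k
    C-suc k = refl

  -- In terms of series, 1 / (1 + x + x²) = (1 - x) / (1 - x³).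
  C-period : ∀ k → C (3 ℕ.+ k) ≡ C k
  C-period k = trans (C-suc (suc k)) (trans (cong (λ t → - t - C (suc k)) (C-suc k)) (identity (C (suc k)) (C k)))
    where
    identity : ∀ x y → - (- x - y) - x ≡ y
    identity = solve-∀

  C-0 : ∀ i → C (i ℕ.* 3) ≡ 0ℤ
  C-0 zero    = C-zero
  C-0 (suc i) = trans (C-period (i ℕ.* 3)) (C-0 i)

  C-1 : ∀ i → C (1 ℕ.+ i ℕ.* 3) ≡ 1ℤ
  C-1 zero    = C-one
  C-1 (suc i) = trans (C-period (1 ℕ.+ i ℕ.* 3)) (C-1 i)

  C-2 : ∀ i → C (2 ℕ.+ i ℕ.* 3) ≡ - 1ℤ
  C-2 zero    = trans (C-suc 0) (cong₂ (λ x y → - x - y) C-one C-zero)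
  C-2 (suc i) = trans (C-period (2 ℕ.+ i ℕ.* 3)) (C-2 i)

  -- Units and inverses modulo p and p².

  module ModPrime (p : ℕ) (p-prime : Prime p) where

    P : ℤ
    P = + p

    P² : ℤ
    P² = P * P

    P≢0 : ℤ.NonZero P
    P≢0 = prime⇒nonZero p-prime

    Unit : ℕ → Set
    Unit k = ¬ (p ℕ.∣ k)

    below-unit : ∀ k l → suc k ℕ.+ suc l ≡ p → Unit (suc k)
    below-unit k l refl = ℕ.>⇒∤ (ℕ.s≤s (ℕ.≤-trans (ℕ.≤-reflexive (ℕ.+-comm 1 k)) (ℕ.+-monoʳ-≤ k (ℕ.s≤s ℕ.z≤n))))

    Unit-* : ∀ {a b} → Unit a → Unit b → Unit (a ℕ.* b)
    Unit-* ua ub = [ ua , ub ]′ ∘ euclidsLemma _ _ p-prime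

    cancel : ∀ {a} → Unit a → ∀ x → P ∣ + a * x → P ∣ x
    cancel {a} ua x h
      with euclidsLemma a ℤ.∣ x ∣ p-prime (subst (p ℕ.∣_) (ℤ.abs-* (+ a) x) (∣⇒∣ᵤ h))
    ... | inj₁ p∣a = contradiction p∣a ua
    ... | inj₂ p∣x = ∣ᵤ⇒∣ p∣x

    P∣P : P ∣ P
    P∣P = ∣-refl

    P²∣P² : P² ∣ P²
    P²∣P² = ∣-refl

    P∣⇒P²∣ : ∀ {x} → P ∣ x → P² ∣ P * x
    P∣⇒P²∣ h = *-monoʳ-∣ P h

    P²∣⇒P∣ : ∀ {x} → P² ∣ x → P ∣ x
    P²∣⇒P∣ h = ∣-trans (P ⊙ P∣P) h

    P²∣⇒P∣/P : ∀ {x} → P² ∣ P * x → P ∣ x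
    P²∣⇒P∣/P h = *-cancelˡ-∣ P {{P≢0}} h

    -- A first use of `cancel` gives x = y p; dividing p² ∣ a y p by p leaves p ∣ a y, and `cancel`
    -- applies again.
    cancel² : ∀ {a} → Unit a → ∀ x → P² ∣ + a * x → P² ∣ x
    cancel² {a} ua x h with cancel ua x (P²∣⇒P∣ h)
    ... | divides y refl = subst (P² ∣_) (ℤ.*-comm P y) (P∣⇒P²∣ (cancel ua y
            (P²∣⇒P∣/P (h by identity (+ a) y P))))
      where
      identity : ∀ a y p → p * (a * y) ≡ a * (y * p)
      identity = solve-∀

    Unit⇒Coprime : ∀ {k} → Unit k → Coprime p k
    Unit⇒Coprime uk (d∣p , d∣k) with prime⇒irreducible p-prime d∣p
    ... | inj₁ d≡1 = d≡1
    ... | inj₂ refl = contradiction d∣k uk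

    inverse : ∀ k → Unit k → ∃ λ v → + k * v ≈ 1ℤ [ P ]
    inverse k k-unit with coprime-Bézout (Unit⇒Coprime k-unit)
    ... | Bézout.+- x y eq = - + y , ((- + x) ⊙ P∣P ⊕ (- 1ℤ) ⊙ ≡⇒≈ (pos-Bézout y k x p eq) by identity (+ k) (+ x) (+ y) P)
      where
      identity : ∀ k x y p → k * (- y) - 1ℤ ≡ (- x) * p + (- 1ℤ) * (1ℤ + y * k - x * p)
      identity = solve-∀
    ... | Bézout.-+ x y eq = + y , (+ x ⊙ P∣P ⊕ (- 1ℤ) ⊙ ≡⇒≈ (pos-Bézout x p y k eq) by identity (+ k) (+ x) (+ y) P)
      where
      identity : ∀ k x y p → k * y - 1ℤ ≡ x * p + (- 1ℤ) * (1ℤ + x * p - y * k)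
      identity = solve-∀

    abstract
      -- u k is the inverse of k modulo p; it has the junk value 0 if p divides k.
      u : ℕ → ℤ
      u k with p ℕ.∣? k
      ... | yes _ = 0ℤ
      ... | no uk = proj₁ (inverse k uk)

      u-inverse : ∀ {k} → Unit k → + k * u k ≈ 1ℤ [ P ]
      u-inverse {k} uk with p ℕ.∣? k
      ... | yes p∣k = contradiction p∣k uk
      ... | no uk′ = proj₂ (inverse k uk′)

    Unit-affine : ∀ s b a j → s ℕ.* b ≡ a ℕ.+ j ℕ.* p → Unit a → Unit b
    Unit-affine s b a j eq ua p∣b = ua (ℕ.∣m+n∣m⇒∣n
      (subst (p ℕ.∣_) (trans eq (ℕ.+-comm a _)) (ℕ.∣n⇒∣m*n s p∣b)) (ℕ.n∣m*n j))

    -- Modulo p, s b ≡ a, hence 1 / b ≡ s / a. When a moves in steps of s, b moves in steps of 1, so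
    -- sums of 1 / a over a residue class modulo s become differences of harmonic numbers.
    u-affine : ∀ s b a j → s ℕ.* b ≡ a ℕ.+ j ℕ.* p → Unit a → u b ≈ + s * u a [ P ]
    u-affine s b a j eq ua =
      (- u b) ⊙ u-inverse ua ⊕ (+ s * u a) ⊙ u-inverse (Unit-affine s b a j eq ua) ⊕ (- (u b * u a * + j)) ⊙ P∣P
        ⊕ (- (u b * u a)) ⊙ ≡⇒≈ (trans (pos-affine s b a (j ℕ.* p) eq) (cong (λ t → + a + t) (pos-* j p)))
        by identity (+ s) (+ b) (+ a) (+ j) (u a) (u b) P
      where
      identity : ∀ s b a j va vb p → vb - s * va ≡
        (- vb) * (a * va - 1ℤ) + (s * va) * (b * vb - 1ℤ) + (- (vb * va * j)) * p + (- (vb * va)) * (s * b - (a + j * p))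
      identity = solve-∀

    -- Harmonic numbers modulo p and their reflection.

    H : ℕ → ℤ
    H zero    = 0ℤ
    H (suc n) = H n + u (suc n)

    u-opposite : ∀ {a b} → a ℕ.+ b ≡ p → Unit a → Unit b → u a + u b ≈ 0ℤ [ P ]
    u-opposite {a} {b} eq ua ub =
      (- u b) ⊙ u-inverse ua ⊕ (- u a) ⊙ u-inverse ub ⊕ (u a * u b) ⊙ ≡⇒≈ (trans (sym (pos-+ a b)) (cong +_ eq))
        ⊕ (u a * u b) ⊙ P∣P
        by identity (+ a) (+ b) (u a) (u b) P
      where
      identity : ∀ a b va vb p → va + vb - 0ℤ ≡
        (- vb) * (a * va - 1ℤ) + (- va) * (b * vb - 1ℤ) + (va * vb) * (a + b - p) + (va * vb) * p
      identity = solve-∀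

    -- Induction on k with k + l fixed: taking 1 / (l + 1) away on the left amounts, by
    -- `u-opposite`, to adding 1 / (k + 1) on the right.
    H-split : ∀ k l → suc (k ℕ.+ l) ≡ p → H l ≈ H k + H (k ℕ.+ l) [ P ]
    H-split zero    l eq = ≡⇒≈ (sym (ℤ.+-identityˡ (H l)))
    H-split (suc k) l eq =
      subst (λ n → H (suc l) ≈ H k + H n [ P ]) (ℕ.+-suc k l) (H-split k (suc l) (trans (cong suc (ℕ.+-suc k l)) eq))
        ⊕ (- 1ℤ) ⊙ u-opposite eq′ (below-unit k l eq′) (below-unit l k (trans (ℕ.+-comm (suc l) (suc k)) eq′))
        by identity (H l) (u (suc l)) (H k) (u (suc k)) (H (suc k ℕ.+ l))
      where
      eq′ : suc k ℕ.+ suc l ≡ p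
      eq′ = trans (cong suc (ℕ.+-suc k l)) eq
      identity : ∀ hl ul hk uk h →
        hl - (hk + uk + h) ≡ (hl + ul - (hk + h)) + (- 1ℤ) * (uk + ul - 0ℤ)
      identity = solve-∀

    -- `H-split` at l = 0 reads 0 ≡ 2 H(p - 1).
    H-full : Unit 2 → ∀ n → suc n ≡ p → H n ≈ 0ℤ [ P ]
    H-full 2-unit n eq = cancel 2-unit _
      ((- 1ℤ) ⊙ subst (λ m → 0ℤ ≈ H n + H m [ P ]) (ℕ.+-identityʳ n)
        (H-split n 0 (trans (cong suc (ℕ.+-identityʳ n)) eq)) by identity (H n))
      where
      identity : ∀ h → + 2 * (h - 0ℤ) ≡ (- 1ℤ) * (0ℤ - (h + h))
      identity = solve-∀

    H-reflect : Unit 2 → ∀ k l → suc (k ℕ.+ l) ≡ p → H k ≈ H l [ P ]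
    H-reflect 2-unit k l eq = (- 1ℤ) ⊙ H-split k l eq ⊕ (- 1ℤ) ⊙ H-full 2-unit (k ℕ.+ l) eq
      by identity (H k) (H l) (H (k ℕ.+ l))
      where
      identity : ∀ x y z → x - y ≡ (- 1ℤ) * (y - (x + z)) + (- 1ℤ) * (z - 0ℤ)
      identity = solve-∀

    -- Products modulo p² and Lerch's formula for Fermat quotients.

    -- Modulo p², the product of the a i = s (b + 1 + i) - j p is (1 - (j p / s) Σ 1/(b + 1 + i)) times that
    -- of the s (b + 1 + i); the factor s on both sides clears the denominator.
    block : ∀ s b j a n → (∀ i → i ℕ.< n → s ℕ.* suc (b ℕ.+ i) ≡ a i ℕ.+ j ℕ.* p) → (∀ i → i ℕ.< n → Unit (a i)) →
      + s * + Π a n ≈ + (s ℕ.^ n ℕ.* Π (λ i → suc (b ℕ.+ i)) n) * (+ s - + j * P * (H (b ℕ.+ n) - H b)) [ P² ]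
    block s b j a zero eq ua rewrite ℕ.+-identityʳ b = ≡⇒≈ (identity (+ s) (+ j) P (H b))
      where
      identity : ∀ s j p h → s * 1ℤ ≡ 1ℤ * (s - j * p * (h - h))
      identity = solve-∀
    block s b j a (suc n) eq ua =
      + a n ⊙ block s b j a n (λ i i<n → eq i (ℕ.m<n⇒m<1+n i<n)) (λ i i<n → ua i (ℕ.m<n⇒m<1+n i<n))
        ⊕ (r * (j′ * j′ * h)) ⊙ P²∣P²
        ⊕ (r * j′ * + s) ⊙ P∣⇒P²∣ (u-inverse (Unit-affine s β (a n) j eqₙ (ua n ℕ.≤-refl)))
        ⊕ (- (r * (+ s - j′ * P * h))) ⊙ ≡⇒≈ (trans (pos-affine s β (a n) (j ℕ.* p) eqₙ) (cong (λ t → + a n + t) (pos-* j p)))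
        by trans (cong₂ _-_ (cong (+ s *_) (pos-* (Π a n) (a n)))
                   (cong₂ (λ x y → x * (+ s - j′ * P * (y - H b)))
                      (trans (cong +_ (regroup s (s ℕ.^ n) R β)) (trans (pos-* (s ℕ.^ n ℕ.* R) (s ℕ.* β)) (cong (r *_) (pos-* s β))))
                      (cong H (ℕ.+-suc b n))))
           (identity (+ s) (+ Π a n) (+ a n) r j′ P (H (b ℕ.+ n)) (H b) (+ β) (u β))
      where
      β = suc (b ℕ.+ n)
      R = Π (λ i → suc (b ℕ.+ i)) n
      r = + (s ℕ.^ n ℕ.* R)
      j′ = + j
      h = H (b ℕ.+ n) - H b
      eqₙ = eq n ℕ.≤-refl
      regroup : ∀ s t R β → s ℕ.* t ℕ.* (R ℕ.* β) ≡ t ℕ.* R ℕ.* (s ℕ.* β)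
      regroup = ℕ.solve-∀
      identity : ∀ s A α r j p h₁ h₀ β v →
        s * (A * α) - r * (s * β) * (s - j * p * (h₁ + v - h₀)) ≡
        α * (s * A - r * (s - j * p * (h₁ - h₀)))
        + (r * (j * j * (h₁ - h₀))) * (p * p)
        + (r * j * s) * (p * (β * v - 1ℤ))
        + (- (r * (s - j * p * (h₁ - h₀)))) * (s * β - (α + j * p))
      identity = solve-∀

    <⇒Unit : ∀ {k} → suc k ℕ.< p → Unit (suc k)
    <⇒Unit k<p = ℕ.>⇒∤ k<p

    Unit-Π : ∀ f n → (∀ i → i ℕ.< n → Unit (f i)) → Unit (Π f n)
    Unit-Π f zero    uf p∣1 = ℕ.nonTrivial⇒≢1 {{prime⇒nonTrivial p-prime}} (ℕ.∣1⇒≡1 p∣1)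
    Unit-Π f (suc n) uf = Unit-* (Unit-Π f n (λ i i<n → uf i (ℕ.m<n⇒m<1+n i<n))) (uf n ℕ.≤-refl)

    -- In use, the `a i` are the numbers a from 1 to p - 1 with a + j p divisible by s, and the
    -- quotients are the consecutive numbers b + 1, ..., b + n.
    Blocks : ℕ → ℕ → ℕ → (ℕ → ℕ) → ℕ → Set
    Blocks s b j a n = ∀ i → i ℕ.< n → s ℕ.* suc (b ℕ.+ i) ≡ a i ℕ.+ j ℕ.* p × Unit (a i)

    FermatQuotient : ℕ → ℤ → Set
    FermatQuotient s q = + (s ℕ.^ (p ℕ.∸ 1)) - 1ℤ ≡ q * P

    -- Lerch's formula s q ≡ Σ ⌊s b / p⌋ / b, the sum over 0 < b < p, for at most three values j =
    -- 0, 1, 2 of ⌊s b / p⌋. The numbers a = s b - j p and the numbers b both have product (p - 1)!;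
    -- comparing the two products modulo p² gives the formula.
    module Lerch (s : ℕ) (a₀ a₁ a₂ : ℕ → ℕ) (n₀ n₁ n₂ m : ℕ) (s-unit : Unit s)
      (b₀ : Blocks s 0 0 a₀ n₀) (b₁ : Blocks s n₀ 1 a₁ n₁) (b₂ : Blocks s (n₀ ℕ.+ n₁) 2 a₂ n₂)
      (n≡m : n₀ ℕ.+ n₁ ℕ.+ n₂ ≡ m) (m≡p-1 : suc m ≡ p)
      (factorial : Π a₀ n₀ ℕ.* Π a₁ n₁ ℕ.* Π a₂ n₂ ≡ Π suc m) where

      private
        S Q F h₁ h₂ e₀ e₁ e₂ : ℤ
        S = + s
        Q = + (s ℕ.^ m)
        F = + Π suc m
        h₁ = H (n₀ ℕ.+ n₁) - H n₀
        h₂ = H (n₀ ℕ.+ n₁ ℕ.+ n₂) - H (n₀ ℕ.+ n₁)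
        -- The zero terms keep the shape that `block` returns for b = 0 and j = 0.
        e₀ = S - 0ℤ * P * (H n₀ - 0ℤ)
        e₁ = S - 1ℤ * P * h₁
        e₂ = S - + 2 * P * h₂

        R₁ R₂ : ℕ
        R₁ = Π (λ i → suc (n₀ ℕ.+ i)) n₁
        R₂ = Π (λ i → suc (n₀ ℕ.+ n₁ ℕ.+ i)) n₂

        c₀ c₁ c₂ : ℤ
        c₀ = + (s ℕ.^ n₀ ℕ.* Π suc n₀)
        c₁ = + (s ℕ.^ n₁ ℕ.* R₁)
        c₂ = + (s ℕ.^ n₂ ℕ.* R₂)

        A₀ A₁ A₂ : ℤ
        A₀ = + Π a₀ n₀
        A₁ = + Π a₁ n₁
        A₂ = + Π a₂ n₂

        pos-*₃ : ∀ x y z → + (x ℕ.* y ℕ.* z) ≡ + x * + y * + z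
        pos-*₃ x y z = trans (pos-* (x ℕ.* y) z) (cong (_* + z) (pos-* x y))

        A-product : A₀ * A₁ * A₂ ≡ F
        A-product = trans (sym (pos-*₃ (Π a₀ n₀) (Π a₁ n₁) (Π a₂ n₂))) (cong +_ factorial)

        power : s ℕ.^ m ≡ s ℕ.^ n₀ ℕ.* s ℕ.^ n₁ ℕ.* s ℕ.^ n₂
        power = trans (cong (s ℕ.^_) (sym n≡m)) (trans (ℕ.^-distribˡ-+-* s (n₀ ℕ.+ n₁) n₂)
          (cong (ℕ._* s ℕ.^ n₂) (ℕ.^-distribˡ-+-* s n₀ n₁)))

        range : Π suc m ≡ Π suc n₀ ℕ.* R₁ ℕ.* R₂
        range = trans (cong (Π suc) (sym n≡m)) (trans (Π-+ suc (n₀ ℕ.+ n₁) n₂)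
          (cong (ℕ._* R₂) (Π-+ suc n₀ n₁)))

        c-product : c₀ * c₁ * c₂ ≡ Q * F
        c-product = trans (sym (pos-*₃ (s ℕ.^ n₀ ℕ.* Π suc n₀) (s ℕ.^ n₁ ℕ.* R₁) (s ℕ.^ n₂ ℕ.* R₂)))
          (trans (cong +_ (trans (regroup (s ℕ.^ n₀) (Π suc n₀) (s ℕ.^ n₁) R₁ (s ℕ.^ n₂) R₂)
            (cong₂ ℕ._*_ (sym power) (sym range)))) (pos-* (s ℕ.^ m) (Π suc m)))
          where
          regroup : ∀ x x′ y y′ z z′ → (x ℕ.* x′) ℕ.* (y ℕ.* y′) ℕ.* (z ℕ.* z′) ≡ (x ℕ.* y ℕ.* z) ℕ.* (x′ ℕ.* y′ ℕ.* z′)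
          regroup = ℕ.solve-∀

        blocks : (S * A₀) * (S * A₁) * (S * A₂) ≈ (c₀ * e₀) * (c₁ * e₁) * (c₂ * e₂) [ P² ]
        blocks = ≈-* ((S * A₀) * (S * A₁)) (S * A₂) ((c₀ * e₀) * (c₁ * e₁)) (c₂ * e₂)
          (≈-* (S * A₀) (S * A₁) (c₀ * e₀) (c₁ * e₁)
            (block s 0 0 a₀ n₀ (λ i i<n → proj₁ (b₀ i i<n)) (λ i i<n → proj₂ (b₀ i i<n)))
            (block s n₀ 1 a₁ n₁ (λ i i<n → proj₁ (b₁ i i<n)) (λ i i<n → proj₂ (b₁ i i<n))))
          (block s (n₀ ℕ.+ n₁) 2 a₂ n₂ (λ i i<n → proj₁ (b₂ i i<n)) (λ i i<n → proj₂ (b₂ i i<n)))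

        F-unit : Unit (Π suc m)
        F-unit = Unit-Π suc m (λ i i<m → <⇒Unit (subst (suc i ℕ.<_) m≡p-1 (ℕ.s≤s i<m)))

        -- In `blocks` the left side carries (p - 1)! by `A-product` and the right side s^(p - 1) (p
        -- - 1)! by `c-product`; the factorial is prime to p and cancels.
        expanded : S * S * S ≈ Q * (e₀ * e₁ * e₂) [ P² ]
        expanded = cancel² F-unit _ (blocks ⊕ (- (S * S * S)) ⊙ ≡⇒≈ A-product ⊕ (e₀ * e₁ * e₂) ⊙ ≡⇒≈ c-product
          by identity S A₀ A₁ A₂ c₀ c₁ c₂ e₀ e₁ e₂ Q F)
          where
          identity : ∀ s A B C c d e x y z q f → f * (s * s * s - q * (x * y * z)) ≡
            ((s * A) * (s * B) * (s * C) - (c * x) * (d * y) * (e * z))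
            + (- (s * s * s)) * (A * B * C - f) + (x * y * z) * (c * d * e - q * f)
          identity = solve-∀

        -- Fermat's little theorem: modulo p each of `e₀`, `e₁`, `e₂` is s, so `expanded` becomes s³
        -- ≡ s³ Q.
        Q≈1 : Q ≈ 1ℤ [ P ]
        Q≈1 = cancel s-unit _ (cancel s-unit _ (cancel s-unit _
          ((- 1ℤ) ⊙ P²∣⇒P∣ expanded
            ⊕ (Q * (S * S * h₁ + + 2 * S * S * h₂ - + 2 * S * P * h₁ * h₂)) ⊙ P∣P by identity S Q P (H n₀) h₁ h₂)))
          where
          identity : ∀ s q p h x y → s * (s * (s * (q - 1ℤ))) ≡
            (- 1ℤ) * (s * s * s - q * ((s - 0ℤ * p * (h - 0ℤ)) * (s - 1ℤ * p * x) * (s - + 2 * p * y)))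
            + (q * (s * s * x + + 2 * s * s * y - + 2 * s * p * x * y)) * p
          identity = solve-∀

      q : ℤ
      q = quotient Q≈1

      q-FermatQuotient : FermatQuotient s q
      q-FermatQuotient = trans (cong (λ n → + (s ℕ.^ n) - 1ℤ) (cong (ℕ._∸ 1) (sym m≡p-1))) (_∣_.equality Q≈1)

      private
        -- With Q = 1 + q p, `expanded` reads s³ ≡ (1 + q p) (s³ - p s² (h₁ + 2 h₂)) modulo p²; the
        -- terms linear in p give the claim after division by p s².
        q-expansion : S * q ≈ h₁ + + 2 * h₂ [ P ]
        q-expansion = cancel s-unit _ (cancel s-unit _ (P²∣⇒P∣/P
          ((- 1ℤ) ⊙ expanded ⊕ (q * S * S * (h₁ + + 2 * h₂) - + 2 * S * (1ℤ + q * P) * h₁ * h₂) ⊙ P²∣P²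
            ⊕ (- (e₀ * e₁ * e₂)) ⊙ ≡⇒≈ (_∣_.equality Q≈1) by identity S Q P (H n₀) h₁ h₂ q)))
          where
          identity : ∀ s Q p h x y q → p * (s * (s * (s * q - (x + + 2 * y)))) ≡
            (- 1ℤ) * (s * s * s - Q * ((s - 0ℤ * p * (h - 0ℤ)) * (s - 1ℤ * p * x) * (s - + 2 * p * y)))
            + (q * s * s * (x + + 2 * y) - + 2 * s * (1ℤ + q * p) * x * y) * (p * p)
            + (- ((s - 0ℤ * p * (h - 0ℤ)) * (s - 1ℤ * p * x) * (s - + 2 * p * y))) * (Q - 1ℤ - q * p)
          identity = solve-∀

      -- Regrouped, h₁ + 2 h₂ is 2 H(p - 1) - H(n₀) - H(n₀ + n₁), and H(p - 1) vanishes modulo p.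
      q-harmonic : Unit 2 → S * q ≈ - (H n₀ + H (n₀ ℕ.+ n₁)) [ P ]
      q-harmonic 2-unit = q-expansion ⊕ + 2 ⊙ H-full 2-unit (n₀ ℕ.+ n₁ ℕ.+ n₂) (trans (cong suc n≡m) m≡p-1)
        by identity (S * q) (H n₀) (H (n₀ ℕ.+ n₁)) (H (n₀ ℕ.+ n₁ ℕ.+ n₂))
        where
        identity : ∀ x h₀ h₁ h₂ → x - - (h₀ + h₁) ≡ (x - (h₁ - h₀ + + 2 * (h₂ - h₁))) + + 2 * (h₂ - 0ℤ)
        identity = solve-∀

    -- The Fermat quotients of 2 and 3 as harmonic numbers.

    q₂-harmonic : Unit 2 → ∀ m → p ≡ suc (m ℕ.* 2) → ∃ λ q → FermatQuotient 2 q × + 2 * q ≈ - H m [ P ]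
    q₂-harmonic 2-unit m refl = q , q-FermatQuotient ,
      (q-harmonic 2-unit ⊕ (- 1ℤ) ⊙ H-full 2-unit (m ℕ.+ m) (cong suc (double m)) by identity (+ 2 * q) (H m) (H (m ℕ.+ m)))
      where
      double : ∀ m → m ℕ.+ m ≡ m ℕ.* 2
      double = ℕ.solve-∀
      identity : ∀ x y z → x - - y ≡ (x - - (y + z)) + (- 1ℤ) * (z - 0ℤ)
      identity = solve-∀
      bound : ∀ {i} → i ℕ.< m → suc (suc (i ℕ.* 2)) ℕ.< p
      bound i<m = ℕ.s≤s (ℕ.*-monoˡ-≤ 2 i<m)
      eq₀ : ∀ i → 2 ℕ.* suc i ≡ suc (suc (i ℕ.* 2)) ℕ.+ 0
      eq₀ = ℕ.solve-∀
      eq₁ : ∀ m i → 2 ℕ.* suc (m ℕ.+ i) ≡ suc (i ℕ.* 2) ℕ.+ 1 ℕ.* suc (m ℕ.* 2)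
      eq₁ = ℕ.solve-∀
      step : ∀ x y i j → x ℕ.* i ℕ.* (y ℕ.* j) ℕ.* 1 ≡ x ℕ.* y ℕ.* 1 ℕ.* j ℕ.* i
      step = ℕ.solve-∀
      factorial : ∀ m → Π (λ i → suc (suc (i ℕ.* 2))) m ℕ.* Π (λ i → suc (i ℕ.* 2)) m ℕ.* 1 ≡ Π suc (m ℕ.* 2)
      factorial zero    = refl
      factorial (suc m) = trans (step (Π (λ i → suc (suc (i ℕ.* 2))) m) (Π (λ i → suc (i ℕ.* 2)) m) (suc (suc (m ℕ.* 2))) (suc (m ℕ.* 2)))
        (cong (λ t → t ℕ.* suc (m ℕ.* 2) ℕ.* suc (suc (m ℕ.* 2))) (factorial m))
      -- Even numbers are 2 b and odd numbers 2 b - p; the third block is empty, with `suc` as a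
      -- placeholder.
      open Lerch 2 (λ i → suc (suc (i ℕ.* 2))) (λ i → suc (i ℕ.* 2)) suc m m 0 (m ℕ.* 2) 2-unit
        (λ i i<m → eq₀ i , <⇒Unit (bound i<m))
        (λ i i<m → eq₁ m i , <⇒Unit (ℕ.<-trans (ℕ.n<1+n _) (bound i<m)))
        (λ i ())
        (trans (ℕ.+-identityʳ (m ℕ.+ m)) (double m)) refl (factorial m)

    factorial₃ : ∀ m → Π (λ i → suc (suc (suc (i ℕ.* 3)))) m ℕ.* Π (λ i → suc (suc (i ℕ.* 3))) m ℕ.* Π (λ i → suc (i ℕ.* 3)) m
      ≡ Π suc (m ℕ.* 3)
    factorial₃ zero    = refl
    factorial₃ (suc m) = trans
      (step (Π (λ i → suc (suc (suc (i ℕ.* 3)))) m) (Π (λ i → suc (suc (i ℕ.* 3))) m) (Π (λ i → suc (i ℕ.* 3)) m)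
        (suc (suc (suc (m ℕ.* 3)))) (suc (suc (m ℕ.* 3))) (suc (m ℕ.* 3)))
      (cong (λ t → t ℕ.* suc (m ℕ.* 3) ℕ.* suc (suc (m ℕ.* 3)) ℕ.* suc (suc (suc (m ℕ.* 3)))) (factorial₃ m))
      where
      step : ∀ x y z i j k → x ℕ.* i ℕ.* (y ℕ.* j) ℕ.* (z ℕ.* k) ≡ x ℕ.* y ℕ.* z ℕ.* k ℕ.* j ℕ.* i
      step = ℕ.solve-∀

    -- The first two blocks end at ⌊p / 3⌋ = m and ⌊2 p / 3⌋ = 2 m, which add up to p - 1, so
    -- reflection identifies the two harmonic numbers.
    q₃-harmonic₁ : Unit 2 → Unit 3 → ∀ m → p ≡ suc (m ℕ.* 3) →
      ∃ λ q → FermatQuotient 3 q × + 3 * q ≈ - (+ 2 * H m) [ P ]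
    q₃-harmonic₁ 2-unit 3-unit m refl = q , q-FermatQuotient ,
      (q-harmonic 2-unit ⊕ H-reflect 2-unit m (m ℕ.+ m) (cong suc (triple′ m)) by identity (+ 3 * q) (H m) (H (m ℕ.+ m)))
      where
      triple : ∀ m → m ℕ.+ m ℕ.+ m ≡ m ℕ.* 3
      triple = ℕ.solve-∀
      triple′ : ∀ m → m ℕ.+ (m ℕ.+ m) ≡ m ℕ.* 3
      triple′ = ℕ.solve-∀
      identity : ∀ x y z → x - - (+ 2 * y) ≡ (x - - (y + z)) + (y - z)
      identity = solve-∀
      bound : ∀ {i} → i ℕ.< m → suc (suc (suc (i ℕ.* 3))) ℕ.< p
      bound i<m = ℕ.s≤s (ℕ.*-monoˡ-≤ 3 i<m)
      eq₀ : ∀ i → 3 ℕ.* suc i ≡ suc (suc (suc (i ℕ.* 3))) ℕ.+ 0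
      eq₀ = ℕ.solve-∀
      eq₁ : ∀ m i → 3 ℕ.* suc (m ℕ.+ i) ≡ suc (suc (i ℕ.* 3)) ℕ.+ 1 ℕ.* suc (m ℕ.* 3)
      eq₁ = ℕ.solve-∀
      eq₂ : ∀ m i → 3 ℕ.* suc (m ℕ.+ m ℕ.+ i) ≡ suc (i ℕ.* 3) ℕ.+ 2 ℕ.* suc (m ℕ.* 3)
      eq₂ = ℕ.solve-∀
      -- As p ≡ 1 modulo 3, divisibility of a + j p by 3 means a ≡ - j, so j = 0, 1, 2 takes the
      -- classes 0, 2, 1.
      open Lerch 3 (λ i → suc (suc (suc (i ℕ.* 3)))) (λ i → suc (suc (i ℕ.* 3))) (λ i → suc (i ℕ.* 3)) m m m (m ℕ.* 3) 3-unit
        (λ i i<m → eq₀ i , <⇒Unit (bound i<m))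
        (λ i i<m → eq₁ m i , <⇒Unit (ℕ.<-trans (ℕ.n<1+n _) (bound i<m)))
        (λ i i<m → eq₂ m i , <⇒Unit (ℕ.<-trans (ℕ.m<n⇒m<1+n (ℕ.n<1+n _)) (bound i<m)))
        (triple m) refl (factorial₃ m)

    q₃-harmonic₂ : Unit 2 → Unit 3 → ∀ m → p ≡ suc (suc (m ℕ.* 3)) →
      ∃ λ q → FermatQuotient 3 q × + 3 * q ≈ - (+ 2 * H m) [ P ]
    q₃-harmonic₂ 2-unit 3-unit m refl = q , q-FermatQuotient ,
      (q-harmonic 2-unit ⊕ H-reflect 2-unit m (m ℕ.+ suc m) (cong suc (triple′ m)) by identity (+ 3 * q) (H m) (H (m ℕ.+ suc m)))
      where
      triple : ∀ m → m ℕ.+ suc m ℕ.+ m ≡ suc (m ℕ.* 3)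
      triple = ℕ.solve-∀
      triple′ : ∀ m → m ℕ.+ (m ℕ.+ suc m) ≡ suc (m ℕ.* 3)
      triple′ = ℕ.solve-∀
      identity : ∀ x y z → x - - (+ 2 * y) ≡ (x - - (y + z)) + (y - z)
      identity = solve-∀
      bound : ∀ {i} → i ℕ.< m → suc (suc (suc (i ℕ.* 3))) ℕ.< p
      bound i<m = ℕ.s≤s (ℕ.m≤n⇒m≤1+n (ℕ.*-monoˡ-≤ 3 i<m))
      bound₁ : ∀ {i} → i ℕ.< suc m → suc (i ℕ.* 3) ℕ.< p
      bound₁ i<m = ℕ.s≤s (ℕ.s≤s (ℕ.*-monoˡ-≤ 3 (ℕ.≤-pred i<m)))
      eq₀ : ∀ i → 3 ℕ.* suc i ≡ suc (suc (suc (i ℕ.* 3))) ℕ.+ 0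
      eq₀ = ℕ.solve-∀
      eq₁ : ∀ m i → 3 ℕ.* suc (m ℕ.+ i) ≡ suc (i ℕ.* 3) ℕ.+ 1 ℕ.* suc (suc (m ℕ.* 3))
      eq₁ = ℕ.solve-∀
      eq₂ : ∀ m i → 3 ℕ.* suc (m ℕ.+ suc m ℕ.+ i) ≡ suc (suc (i ℕ.* 3)) ℕ.+ 2 ℕ.* suc (suc (m ℕ.* 3))
      eq₂ = ℕ.solve-∀
      regroup : ∀ x y z i → x ℕ.* (z ℕ.* i) ℕ.* y ≡ x ℕ.* y ℕ.* z ℕ.* i
      regroup = ℕ.solve-∀
      -- As p ≡ - 1 modulo 3, now a ≡ j, and the class of 1 has the additional member p - 1 = 3 m +
      -- 1.
      open Lerch 3 (λ i → suc (suc (suc (i ℕ.* 3)))) (λ i → suc (i ℕ.* 3)) (λ i → suc (suc (i ℕ.* 3))) m (suc m) m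
        (suc (m ℕ.* 3)) 3-unit
        (λ i i<m → eq₀ i , <⇒Unit (bound i<m))
        (λ i i<m → eq₁ m i , <⇒Unit (bound₁ i<m))
        (λ i i<m → eq₂ m i , <⇒Unit (ℕ.<-trans (ℕ.n<1+n _) (bound i<m)))
        (triple m) refl
        (trans (regroup (Π (λ i → suc (suc (suc (i ℕ.* 3)))) m) (Π (λ i → suc (suc (i ℕ.* 3))) m)
            (Π (λ i → suc (i ℕ.* 3)) m) (suc (m ℕ.* 3)))
          (cong (ℕ._* suc (m ℕ.* 3)) (factorial₃ m)))

    -- The first-order term h of the trinomial coefficients.

    abstract

      h : ℕ → ℤ
      h zero          = 0ℤ
      h (suc zero)    = 0ℤ
      h (suc (suc k)) = u (suc k) * (C (suc k) + + 2 * C k) - h (suc k) - h k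

      h-zero : h 0 ≡ 0ℤ
      h-zero = refl

      h-one : h 1 ≡ 0ℤ
      h-one = refl

      h-suc : ∀ k → h (2 ℕ.+ k) ≡ u (1 ℕ.+ k) * (C (1 ℕ.+ k) + + 2 * C k) - h (1 ℕ.+ k) - h k
      h-suc k = refl

    h-two : h 2 ≡ u 1
    h-two = trans (h-suc 0) (trans (cong₂ (λ x y → u 1 * (C 1 + + 2 * C 0) - x - y) h-one h-zero)
      (trans (cong₂ (λ x y → u 1 * (x + + 2 * y) - 0ℤ - 0ℤ) C-one C-zero) (identity (u 1))))
      where
      identity : ∀ x → x * (1ℤ + + 2 * 0ℤ) - 0ℤ - 0ℤ ≡ x
      identity = solve-∀

    h-three : h 3 ≡ u 2 - u 1
    h-three = trans (h-suc 1) (trans (cong₂ (λ x y → u 2 * (C 2 + + 2 * C 1) - x - y) h-two h-one)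
      (trans (cong₂ (λ x y → u 2 * (x + + 2 * y) - u 1 - 0ℤ) (C-2 0) C-one) (identity (u 1) (u 2))))
      where
      identity : ∀ x y → y * (- 1ℤ + + 2 * 1ℤ) - x - 0ℤ ≡ y - x
      identity = solve-∀

    -- Both sides satisfy T-recurrence modulo p², in which the factor k + 1 is invertible for k + 1 < p.
    T≈ : ∀ m ν → + m ≡ ν * P - 1ℤ → ∀ k → k ℕ.≤ p → T m k ≈ C k + ν * P * h k [ P² ]
    T≈ m ν eq zero          k≤p = ≡⇒≈ (trans (identity ν P) (sym (cong₂ (λ x y → x + ν * P * y) C-zero h-zero)))
      where
      identity : ∀ ν p → 0ℤ ≡ 0ℤ + ν * p * 0ℤ
      identity = solve-∀
    T≈ m ν eq (suc zero)    k≤p = ≡⇒≈ (trans (T-1 m) (trans (identity ν P) (sym (cong₂ (λ x y → x + ν * P * y) C-one h-one))))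
      where
      T-1 : ∀ m → T m 1 ≡ 1ℤ
      T-1 zero    = refl
      T-1 (suc m) = trans (T-suc-1 m) (T-1 m)
      identity : ∀ ν p → 1ℤ ≡ 1ℤ + ν * p * 0ℤ
      identity = solve-∀
    T≈ m ν eq (suc (suc k)) k≤p = cancel² k-unit _
      ( ≡⇒≈ (T-recurrence m k) ⊕ (T m (suc k) + + 2 * T m k) ⊙ ≡⇒≈ eq
      ⊕ (ν * P - 1ℤ - + k) ⊙ T≈ m ν eq (suc k) (ℕ.<⇒≤ k≤p)
      ⊕ (+ 2 * ν * P - 1ℤ - + k) ⊙ T≈ m ν eq k (ℕ.<⇒≤ (ℕ.<⇒≤ k≤p))
      ⊕ (ν * ν * (h (suc k) + + 2 * h k)) ⊙ P²∣P²
      ⊕ (- (ν * (C (suc k) + + 2 * C k))) ⊙ P∣⇒P²∣ (u-inverse k-unit)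
      by trans (cong₂ (λ x y → (1ℤ + + k) * (T m (2 ℕ.+ k) - (x + ν * P * y))) (C-suc k) (h-suc k))
           (identity (+ m) ν P (+ k) (T m (2 ℕ.+ k)) (T m (suc k)) (T m k) (C (suc k)) (C k) (h (suc k)) (h k) (u (suc k))))
      where
      k-unit : Unit (suc k)
      k-unit = <⇒Unit k≤p
      identity : ∀ m ν p k t₂ t₁ t₀ c₁ c₀ h₁ h₀ u →
        (1ℤ + k) * (t₂ - (- c₁ - c₀ + ν * p * (u * (c₁ + + 2 * c₀) - h₁ - h₀))) ≡
        ((1ℤ + k) * t₂ - ((m - k) * t₁ + (+ 2 * m - k + 1ℤ) * t₀)) + (t₁ + + 2 * t₀) * (m - (ν * p - 1ℤ))
        + (ν * p - 1ℤ - k) * (t₁ - (c₁ + ν * p * h₁))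
        + (+ 2 * ν * p - 1ℤ - k) * (t₀ - (c₀ + ν * p * h₀))
        + (ν * ν * (h₁ + + 2 * h₀)) * (p * p)
        + (- (ν * (c₁ + + 2 * c₀))) * (p * ((1ℤ + k) * u - 1ℤ))
      identity = solve-∀

    -- Closed forms of h along the index classes modulo 3.

    h-step : ∀ k → h (4 ℕ.+ k) ≡
      u (3 ℕ.+ k) * (C (3 ℕ.+ k) + + 2 * C (2 ℕ.+ k)) - u (2 ℕ.+ k) * (C (2 ℕ.+ k) + + 2 * C (1 ℕ.+ k)) + h (1 ℕ.+ k)
    h-step k = trans (h-suc (2 ℕ.+ k)) (trans (cong (λ t → a - t - h (2 ℕ.+ k)) (h-suc (1 ℕ.+ k)))
      (identity a (u (2 ℕ.+ k) * (C (2 ℕ.+ k) + + 2 * C (1 ℕ.+ k))) (h (2 ℕ.+ k)) (h (1 ℕ.+ k))))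
      where
      a = u (3 ℕ.+ k) * (C (3 ℕ.+ k) + + 2 * C (2 ℕ.+ k))
      identity : ∀ x y z w → x - (y - z - w) - z ≡ x - y + w
      identity = solve-∀

    -- Two consecutive instances of `h-suc` differ by a relation between values of h three apart
    -- (`h-step`), and C is constant on classes modulo 3. The suffix is the class of the index of h.
    h-step-1 : ∀ i → h (4 ℕ.+ i ℕ.* 3) ≡ h (1 ℕ.+ i ℕ.* 3) - + 2 * u (3 ℕ.+ i ℕ.* 3) - u (2 ℕ.+ i ℕ.* 3)
    h-step-1 i rewrite h-step (i ℕ.* 3) | C-0 (suc i) | C-2 i | C-1 i =
      identity (u (3 ℕ.+ i ℕ.* 3)) (u (2 ℕ.+ i ℕ.* 3)) (h (1 ℕ.+ i ℕ.* 3))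
      where
      identity : ∀ x y z → x * (0ℤ + + 2 * (- 1ℤ)) - y * (- 1ℤ + + 2 * 1ℤ) + z ≡ z - + 2 * x - y
      identity = solve-∀

    h-step-2 : ∀ i → h (5 ℕ.+ i ℕ.* 3) ≡ h (2 ℕ.+ i ℕ.* 3) + u (4 ℕ.+ i ℕ.* 3) + + 2 * u (3 ℕ.+ i ℕ.* 3)
    h-step-2 i rewrite h-step (1 ℕ.+ i ℕ.* 3) | C-1 (suc i) | C-0 (suc i) | C-2 i =
      identity (u (4 ℕ.+ i ℕ.* 3)) (u (3 ℕ.+ i ℕ.* 3)) (h (2 ℕ.+ i ℕ.* 3))
      where
      identity : ∀ x y z → x * (1ℤ + + 2 * 0ℤ) - y * (0ℤ + + 2 * (- 1ℤ)) + z ≡ z + x + + 2 * y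
      identity = solve-∀

    h-step-0 : ∀ i → h (6 ℕ.+ i ℕ.* 3) ≡ h (3 ℕ.+ i ℕ.* 3) + u (5 ℕ.+ i ℕ.* 3) - u (4 ℕ.+ i ℕ.* 3)
    h-step-0 i rewrite h-step (2 ℕ.+ i ℕ.* 3) | C-2 (suc i) | C-1 (suc i) | C-0 (suc i) =
      identity (u (5 ℕ.+ i ℕ.* 3)) (u (4 ℕ.+ i ℕ.* 3)) (h (3 ℕ.+ i ℕ.* 3))
      where
      identity : ∀ x y z → x * (- 1ℤ + + 2 * 1ℤ) - y * (1ℤ + + 2 * 0ℤ) + z ≡ z + x - y
      identity = solve-∀

    u-multiple : ∀ i → suc (suc (suc (i ℕ.* 3))) ℕ.< p → u (suc i) ≈ + 3 * u (3 ℕ.+ i ℕ.* 3) [ P ]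
    u-multiple i b = u-affine 3 (suc i) (3 ℕ.+ i ℕ.* 3) 0 (eq i) (<⇒Unit b)
      where
      eq : ∀ i → 3 ℕ.* suc i ≡ suc (suc (suc (i ℕ.* 3))) ℕ.+ 0
      eq = ℕ.solve-∀

    -- Each step adds -2 / (3i + 3) - 1 / (3i + 2) to h. Tripled, these are -2 / (i + 1) and, since
    -- 3 (m + i + 1) = 3i + 2 + p, -1 / (m + i + 1) modulo p.
    h-closed-1 : ∀ m → p ≡ suc (m ℕ.* 3) → ∀ i → i ℕ.≤ m →
      + 3 * h (1 ℕ.+ i ℕ.* 3) ≈ - (+ 2 * H i) - (H (m ℕ.+ i) - H m) [ P ]
    h-closed-1 m refl zero    i≤m rewrite ℕ.+-identityʳ m | h-one = ≡⇒≈ (identity (H m))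
      where
      identity : ∀ x → + 3 * 0ℤ ≡ - (+ 2 * 0ℤ) - (x - x)
      identity = solve-∀
    h-closed-1 m refl (suc i) i≤m rewrite h-step-1 i | ℕ.+-suc m i =
      h-closed-1 m refl i (ℕ.<⇒≤ i≤m)
      ⊕ + 2 ⊙ u-multiple i bound ⊕ u-affine 3 (suc (m ℕ.+ i)) (2 ℕ.+ i ℕ.* 3) 1 (eq m i) (<⇒Unit (ℕ.<⇒≤ bound))
      by identity (h (1 ℕ.+ i ℕ.* 3)) (u (3 ℕ.+ i ℕ.* 3)) (u (2 ℕ.+ i ℕ.* 3)) (H i) (H (m ℕ.+ i)) (H m) (u (suc i)) (u (suc (m ℕ.+ i)))
      where
      bound : suc (suc (suc (i ℕ.* 3))) ℕ.< p
      bound = ℕ.s≤s (ℕ.*-monoˡ-≤ 3 i≤m)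
      eq : ∀ m i → 3 ℕ.* suc (m ℕ.+ i) ≡ suc (suc (i ℕ.* 3)) ℕ.+ 1 ℕ.* suc (m ℕ.* 3)
      eq = ℕ.solve-∀
      identity : ∀ h a b x y z v w → + 3 * (h - + 2 * a - b) - (- (+ 2 * (x + v)) - (y + w - z)) ≡
        (+ 3 * h - (- (+ 2 * x) - (y - z))) + + 2 * (v - + 3 * a) + (w - + 3 * b)
      identity = solve-∀

    h-closed-2 : ∀ m → p ≡ suc (suc (m ℕ.* 3)) → ∀ i → i ℕ.≤ m →
      + 3 * h (2 ℕ.+ i ℕ.* 3) ≈ + 2 * H i + (H (suc (m ℕ.+ i)) - H m) [ P ]
    -- The initial value h 2 = 1 / 1 already contributes the term 1 / (m + 1), because 3 (m + 1) = 1
    -- + p.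
    h-closed-2 m refl zero    i≤m = subst (λ t → + 3 * h 2 ≈ 0ℤ + (H (suc t) - H m) [ P ]) (sym (ℕ.+-identityʳ m))
      ((- 1ℤ) ⊙ u-affine 3 (suc m) 1 1 (eq m) (<⇒Unit (ℕ.s≤s (ℕ.s≤s ℕ.z≤n))) by trans (cong (λ t → + 3 * t - (0ℤ + (H m + u (suc m) - H m))) h-two) (identity (u 1) (H m) (u (suc m))))
      where
      eq : ∀ m → 3 ℕ.* suc m ≡ 1 ℕ.+ 1 ℕ.* suc (suc (m ℕ.* 3))
      eq = ℕ.solve-∀
      identity : ∀ x y z → + 3 * x - (0ℤ + (y + z - y)) ≡ (- 1ℤ) * (z - + 3 * x)
      identity = solve-∀
    h-closed-2 m refl (suc i) i≤m rewrite h-step-2 i | ℕ.+-suc m i =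
      h-closed-2 m refl i (ℕ.<⇒≤ i≤m)
      ⊕ (- + 2) ⊙ u-multiple i (ℕ.m<n⇒m<1+n bound) ⊕ (- 1ℤ) ⊙ u-affine 3 (suc (suc (m ℕ.+ i))) (4 ℕ.+ i ℕ.* 3) 1 (eq m i) (<⇒Unit (ℕ.s≤s bound))
      by identity (h (2 ℕ.+ i ℕ.* 3)) (u (3 ℕ.+ i ℕ.* 3)) (u (4 ℕ.+ i ℕ.* 3)) (H i) (H (suc (m ℕ.+ i))) (H m) (u (suc i)) (u (suc (suc (m ℕ.+ i))))
      where
      bound : suc (suc (suc (i ℕ.* 3))) ℕ.< suc (m ℕ.* 3)
      bound = ℕ.s≤s (ℕ.*-monoˡ-≤ 3 i≤m)
      eq : ∀ m i → 3 ℕ.* suc (suc (m ℕ.+ i)) ≡ suc (suc (suc (suc (i ℕ.* 3)))) ℕ.+ 1 ℕ.* suc (suc (m ℕ.* 3))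
      eq = ℕ.solve-∀
      identity : ∀ h a b x y z v w → + 3 * (h + b + + 2 * a) - (+ 2 * (x + v) + (y + w - z)) ≡
        (+ 3 * h - (+ 2 * x + (y - z))) + (- + 2) * (v - + 3 * a) + (- 1ℤ) * (w - + 3 * b)
      identity = solve-∀

    -- The summands are 1 / (3i + 2) - 1 / (3i + 1). Adding 2 p and p to the denominators makes them
    -- multiples of 3, so the two runs start just after ⌊2 p / 3⌋ = 2 m + 1 and ⌊p / 3⌋ = m.
    h-closed-0 : ∀ m → p ≡ suc (suc (m ℕ.* 3)) → ∀ i → i ℕ.< m →
      + 3 * h (3 ℕ.+ i ℕ.* 3) ≈ (H (suc (m ℕ.+ suc m ℕ.+ i)) - H (m ℕ.+ suc m)) - (H (suc (m ℕ.+ i)) - H m) [ P ]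
    h-closed-0 m refl i i<m = go i i<m
      where
      bound : ∀ {i} → i ℕ.< m → suc (suc (suc (i ℕ.* 3))) ℕ.< p
      bound i<m = ℕ.s≤s (ℕ.m≤n⇒m≤1+n (ℕ.*-monoˡ-≤ 3 i<m))
      eq₁ : ∀ m i → 3 ℕ.* suc (m ℕ.+ i) ≡ suc (i ℕ.* 3) ℕ.+ 1 ℕ.* suc (suc (m ℕ.* 3))
      eq₁ = ℕ.solve-∀
      eq₂ : ∀ m i → 3 ℕ.* suc (m ℕ.+ suc m ℕ.+ i) ≡ suc (suc (i ℕ.* 3)) ℕ.+ 2 ℕ.* suc (suc (m ℕ.* 3))
      eq₂ = ℕ.solve-∀
      u₁ : ∀ i → i ℕ.< m → u (suc (m ℕ.+ i)) ≈ + 3 * u (1 ℕ.+ i ℕ.* 3) [ P ]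
      u₁ i i<m = u-affine 3 (suc (m ℕ.+ i)) (1 ℕ.+ i ℕ.* 3) 1 (eq₁ m i) (<⇒Unit (ℕ.<⇒≤ (ℕ.<⇒≤ (bound i<m))))
      u₂ : ∀ i → i ℕ.< m → u (suc (m ℕ.+ suc m ℕ.+ i)) ≈ + 3 * u (2 ℕ.+ i ℕ.* 3) [ P ]
      u₂ i i<m = u-affine 3 (suc (m ℕ.+ suc m ℕ.+ i)) (2 ℕ.+ i ℕ.* 3) 2 (eq₂ m i) (<⇒Unit (ℕ.<⇒≤ (bound i<m)))
      go : ∀ i → i ℕ.< m →
        + 3 * h (3 ℕ.+ i ℕ.* 3) ≈ (H (suc (m ℕ.+ suc m ℕ.+ i)) - H (m ℕ.+ suc m)) - (H (suc (m ℕ.+ i)) - H m) [ P ]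
      go zero    i<m = u₁ 0 i<m ⊕ (- 1ℤ) ⊙ u₂ 0 i<m
        by trans (cong₂ _-_ (cong (+ 3 *_) h-three)
                 (cong₂ (λ s t → (H s + u (suc (m ℕ.+ suc m ℕ.+ 0)) - H (m ℕ.+ suc m)) - (H t + u (suc (m ℕ.+ 0)) - H m))
                   (ℕ.+-identityʳ (m ℕ.+ suc m)) (ℕ.+-identityʳ m)))
             (identity (u 1) (u 2) (H (m ℕ.+ suc m)) (H m) (u (suc (m ℕ.+ suc m ℕ.+ 0))) (u (suc (m ℕ.+ 0))))
        where
        identity : ∀ a b x y v w → + 3 * (b - a) - ((x + v - x) - (y + w - y)) ≡
          (w - + 3 * a) + (- 1ℤ) * (v - + 3 * b)
        identity = solve-∀
      go (suc i) i<m = go i (ℕ.<⇒≤ i<m) ⊕ u₁ (suc i) i<m ⊕ (- 1ℤ) ⊙ u₂ (suc i) i<m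
        by trans (cong₂ _-_ (cong (+ 3 *_) (h-step-0 i))
                 (cong₂ (λ s t → (H s + u (suc (m ℕ.+ suc m ℕ.+ suc i)) - H (m ℕ.+ suc m)) - (H t + u (suc (m ℕ.+ suc i)) - H m))
                   (ℕ.+-suc (m ℕ.+ suc m) i) (ℕ.+-suc m i)))
             (identity (h (3 ℕ.+ i ℕ.* 3)) (u (4 ℕ.+ i ℕ.* 3)) (u (5 ℕ.+ i ℕ.* 3)) (H (suc (m ℕ.+ suc m ℕ.+ i))) (H (m ℕ.+ suc m))
               (H (suc (m ℕ.+ i))) (H m) (u (suc (m ℕ.+ suc m ℕ.+ suc i))) (u (suc (m ℕ.+ suc i))))
        where
        identity : ∀ h a b x x′ y y′ v w → + 3 * (h + b - a) - ((x + v - x′) - (y + w - y′)) ≡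
          (+ 3 * h - ((x - x′) - (y - y′))) + (w - + 3 * a) + (- 1ℤ) * (v - + 3 * b)
        identity = solve-∀

    -- The duplication relation for harmonic numbers.

    u-odd : ∀ m → p ≡ suc (m ℕ.* 2) → ∀ i → i ℕ.< m → u (suc (m ℕ.+ i)) ≈ + 2 * u (1 ℕ.+ i ℕ.* 2) [ P ]
    u-odd m refl i i<m = u-affine 2 (suc (m ℕ.+ i)) (1 ℕ.+ i ℕ.* 2) 1 (eq m i) (<⇒Unit (ℕ.s≤s (ℕ.<⇒≤ (ℕ.*-monoˡ-≤ 2 i<m))))
      where
      eq : ∀ m i → 2 ℕ.* suc (m ℕ.+ i) ≡ suc (i ℕ.* 2) ℕ.+ 1 ℕ.* suc (m ℕ.* 2)
      eq = ℕ.solve-∀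

    u-even : ∀ m → p ≡ suc (m ℕ.* 2) → ∀ i → i ℕ.< m → u (suc i) ≈ + 2 * u (2 ℕ.+ i ℕ.* 2) [ P ]
    u-even m refl i i<m = u-affine 2 (suc i) (2 ℕ.+ i ℕ.* 2) 0 (eq i) (<⇒Unit (ℕ.s≤s (ℕ.*-monoˡ-≤ 2 i<m)))
      where
      eq : ∀ i → 2 ℕ.* suc i ≡ suc (suc (i ℕ.* 2)) ℕ.+ 0
      eq = ℕ.solve-∀

    -- The even terms, doubled, sum to H(i). An odd a equals 2 b - p with b running from m + 1, so
    -- its doubled reciprocal is 1 / b modulo p.
    H-double : ∀ m → p ≡ suc (m ℕ.* 2) → ∀ i → i ℕ.≤ m → + 2 * H (i ℕ.* 2) ≈ H i + (H (m ℕ.+ i) - H m) [ P ]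
    H-double m eq zero    i≤m = ≡⇒≈ (trans (identity (H m)) (cong (λ t → 0ℤ + (H t - H m)) (sym (ℕ.+-identityʳ m))))
      where
      identity : ∀ x → + 2 * 0ℤ ≡ 0ℤ + (x - x)
      identity = solve-∀
    H-double m eq (suc i) i≤m = H-double m eq i (ℕ.<⇒≤ i≤m) ⊕ (- 1ℤ) ⊙ u-odd m eq i i≤m ⊕ (- 1ℤ) ⊙ u-even m eq i i≤m
      by trans (cong (λ t → + 2 * H (2 ℕ.+ i ℕ.* 2) - (H (suc i) + (H t - H m))) (ℕ.+-suc m i))
        (identity (H (i ℕ.* 2)) (u (1 ℕ.+ i ℕ.* 2)) (u (2 ℕ.+ i ℕ.* 2)) (H i) (u (suc i)) (H (m ℕ.+ i)) (u (suc (m ℕ.+ i))) (H m))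
      where
      identity : ∀ x a b y v z w t → + 2 * (x + a + b) - (y + v + (z + w - t)) ≡
        (+ 2 * x - (y + (z - t))) + (- 1ℤ) * (w - + 2 * a) + (- 1ℤ) * (v - + 2 * b)
      identity = solve-∀

    H-double′ : ∀ m → p ≡ suc (m ℕ.* 2) → ∀ i → i ℕ.< m → + 2 * H (1 ℕ.+ i ℕ.* 2) ≈ H i + (H (suc (m ℕ.+ i)) - H m) [ P ]
    H-double′ m eq i i<m = H-double m eq i (ℕ.<⇒≤ i<m) ⊕ (- 1ℤ) ⊙ u-odd m eq i i<m
      by identity (H (i ℕ.* 2)) (u (1 ℕ.+ i ℕ.* 2)) (H i) (H (m ℕ.+ i)) (u (suc (m ℕ.+ i))) (H m)
      where
      identity : ∀ x a y z w t → + 2 * (x + a) - (y + (z + w - t)) ≡ (+ 2 * x - (y + (z - t))) + (- 1ℤ) * (w - + 2 * a)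
      identity = solve-∀

    -- The values of h in the middle involve q₃ / 2; working with 2 h keeps them integral.
    T-lift : ∀ m ν k z → + m ≡ ν * P - 1ℤ → k ℕ.≤ p → + 2 * h k ≈ z [ P ] → + 2 * T m k ≈ + 2 * C k + ν * P * z [ P² ]
    T-lift m ν k z eq k≤p h≈z = + 2 ⊙ T≈ m ν eq k k≤p ⊕ ν ⊙ P∣⇒P²∣ h≈z by identity ν P (T m k) (C k) (h k) z
      where
      identity : ∀ ν p t c h z → + 2 * t - (+ 2 * c + ν * p * z) ≡ + 2 * (t - (c + ν * p * h)) + ν * (p * (+ 2 * h - z))
      identity = solve-∀

    -- Values of h for the coefficients of index p - 1 and (p - 1) / 2.

    module _ (2-unit : Unit 2) (3-unit : Unit 3) where

      -- By reflection H(2 m) ≡ H(m), so `h-closed-1` collapses to 3 h ≡ -2 H(m) ≡ 3 q₃.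
      h-at-p-1₁ : ∀ m → p ≡ suc (m ℕ.* 3) → ∃ λ q → FermatQuotient 3 q × + 2 * h (1 ℕ.+ m ℕ.* 3) ≈ + 2 * q [ P ]
      h-at-p-1₁ m eq with q , fq , hq ← q₃-harmonic₁ 2-unit 3-unit m eq = q , fq , cancel 3-unit _
        (+ 2 ⊙ h-closed-1 m eq m ℕ.≤-refl ⊕ (- + 2) ⊙ hq ⊕ + 2 ⊙ H-reflect 2-unit m (m ℕ.+ m) (trans (cong suc (triple m)) (sym eq))
          by identity (h (1 ℕ.+ m ℕ.* 3)) q (H m) (H (m ℕ.+ m)))
        where
        triple : ∀ m → m ℕ.+ (m ℕ.+ m) ≡ m ℕ.* 3
        triple = ℕ.solve-∀
        identity : ∀ h q x y → + 3 * (+ 2 * h - + 2 * q) ≡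
          + 2 * (+ 3 * h - (- (+ 2 * x) - (y - x))) + (- + 2) * (+ 3 * q - - (+ 2 * x)) + + 2 * (x - y)
        identity = solve-∀

      h-at-p-1₂ : ∀ m → p ≡ suc (suc (m ℕ.* 3)) →
        ∃ λ q → FermatQuotient 3 q × + 2 * h (2 ℕ.+ m ℕ.* 3) ≈ - (+ 2 * q) [ P ]
      h-at-p-1₂ m eq with q , fq , hq ← q₃-harmonic₂ 2-unit 3-unit m eq = q , fq , cancel 3-unit _
        (+ 2 ⊙ h-closed-2 m eq m ℕ.≤-refl ⊕ + 2 ⊙ hq
          ⊕ (- + 2) ⊙ H-reflect 2-unit m (suc (m ℕ.+ m)) (trans (cong suc (triple m)) (sym eq))
          by identity (h (2 ℕ.+ m ℕ.* 3)) q (H m) (H (suc (m ℕ.+ m))))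
        where
        triple : ∀ m → m ℕ.+ suc (m ℕ.+ m) ≡ suc (m ℕ.* 3)
        triple = ℕ.solve-∀
        identity : ∀ h q x y → + 3 * (+ 2 * h - - (+ 2 * q)) ≡
          + 2 * (+ 3 * h - (+ 2 * x + (y - x))) + + 2 * (+ 3 * q - - (+ 2 * x)) + (- + 2) * (x - y)
        identity = solve-∀

      -- `h-closed-1` gives 3 h ≡ -2 H(m) - H(3 m) + H(2 m). Duplication together with H(4 m) ≡ H(2
      -- m) gives H(m) ≡ H(2 m) + H(3 m), hence 3 h ≡ - H(2 m) - 3 H(3 m), where 2 H(2 m) ≡ -3 q₃
      -- and H(3 m) ≡ -2 q₂.
      h-at-half₁ : ∀ m → p ≡ suc (m ℕ.* 6) →
        ∃ λ q₂ → ∃ λ q₃ → FermatQuotient 2 q₂ × FermatQuotient 3 q₃ × + 2 * h (1 ℕ.+ m ℕ.* 3) ≈ + 4 * q₂ + q₃ [ P ]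
      h-at-half₁ m eq
        with q₂ , fq₂ , hq₂ ← q₂-harmonic 2-unit (m ℕ.* 3) (trans eq (cong suc (sym (ℕ.*-assoc m 3 2))))
        with q₃ , fq₃ , hq₃ ← q₃-harmonic₁ 2-unit 3-unit (m ℕ.* 2) (trans eq (cong suc (sym (ℕ.*-assoc m 2 3)))) =
        q₂ , q₃ , fq₂ , fq₃ , cancel 3-unit _
          ( + 2 ⊙ h-closed-1 (m ℕ.* 2) (trans eq (cong suc (sym (ℕ.*-assoc m 2 3)))) m (ℕ.m≤m*n m 2)
          ⊕ (- + 6) ⊙ hq₂ ⊕ (- 1ℤ) ⊙ hq₃
          ⊕ + 4 ⊙ H-double (m ℕ.* 3) (trans eq (cong suc (sym (ℕ.*-assoc m 3 2)))) m (ℕ.m≤m*n m 3)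
          ⊕ (- + 4) ⊙ H-reflect 2-unit (m ℕ.* 2) (m ℕ.* 3 ℕ.+ m) (trans (cong suc (sum₁ m)) (sym eq))
          ⊕ (- + 2) ⊙ ≡⇒≈ (cong H (sum₂ m))
          by identity (h (1 ℕ.+ m ℕ.* 3)) q₂ q₃ (H m) (H (m ℕ.* 2)) (H (m ℕ.* 3)) (H (m ℕ.* 3 ℕ.+ m)) (H (m ℕ.* 2 ℕ.+ m)))
        where
        sum₁ : ∀ m → m ℕ.* 2 ℕ.+ (m ℕ.* 3 ℕ.+ m) ≡ m ℕ.* 6
        sum₁ = ℕ.solve-∀
        sum₂ : ∀ m → m ℕ.* 2 ℕ.+ m ≡ m ℕ.* 3
        sum₂ = ℕ.solve-∀
        identity : ∀ h q₂ q₃ x₁ x₂ x₃ x₄ y → + 3 * (+ 2 * h - (+ 4 * q₂ + q₃)) ≡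
          + 2 * (+ 3 * h - (- (+ 2 * x₁) - (y - x₂))) + (- + 6) * (+ 2 * q₂ - - x₃) + (- 1ℤ) * (+ 3 * q₃ - - (+ 2 * x₂))
          + + 4 * (+ 2 * x₂ - (x₁ + (x₄ - x₃))) + (- + 4) * (x₂ - x₄) + (- + 2) * (y - x₃)
        identity = solve-∀

      5+6m≡2+3a : ∀ m → 5 ℕ.+ m ℕ.* 6 ≡ suc (suc ((1 ℕ.+ m ℕ.* 2) ℕ.* 3))
      5+6m≡2+3a = ℕ.solve-∀

      -- With a = ⌊p / 3⌋ and b = ⌊p / 2⌋, reflection turns `h-closed-0` into 3 h ≡ H(m) - H(b),
      -- which is H(a) by duplication and H(4 m + 3) ≡ H(a). As 2 H(a) ≡ -3 q₃, only q₃ survives.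
      h-at-half₅ : ∀ m → p ≡ 5 ℕ.+ m ℕ.* 6 →
        ∃ λ q₃ → FermatQuotient 3 q₃ × + 2 * h (3 ℕ.+ m ℕ.* 3) ≈ - q₃ [ P ]
      h-at-half₅ m eq
        with q₃ , fq₃ , hq₃ ← q₃-harmonic₂ 2-unit 3-unit (1 ℕ.+ m ℕ.* 2) (trans eq (5+6m≡2+3a m)) =
        q₃ , fq₃ , cancel 3-unit _
          ( + 2 ⊙ h-closed-0 a (trans eq (5+6m≡2+3a m)) m (ℕ.s≤s (ℕ.m≤m*n m 2))
          ⊕ 1ℤ ⊙ hq₃
          ⊕ (- + 2) ⊙ H-double′ b (trans eq (p₂ m)) m (ℕ.s≤s (ℕ.≤-trans (ℕ.m≤m*n m 3) (ℕ.n≤1+n _)))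
          ⊕ (- + 2) ⊙ H-reflect 2-unit m (suc (a ℕ.+ suc a ℕ.+ m)) (trans (cong suc (sum₁ m)) (sym eq))
          ⊕ + 2 ⊙ H-reflect 2-unit a (a ℕ.+ suc a) (trans (cong suc (sum₂ m)) (sym eq))
          ⊕ + 2 ⊙ H-reflect 2-unit a (suc (b ℕ.+ m)) (trans (cong suc (sum₃ m)) (sym eq))
          ⊕ (- + 2) ⊙ ≡⇒≈ (cong H (sum₄ m))
          by identity (h (3 ℕ.+ m ℕ.* 3)) q₃ (H m) (H a) (H b) (H (suc (a ℕ.+ suc a ℕ.+ m))) (H (a ℕ.+ suc a))
               (H (suc (b ℕ.+ m))) (H (suc (a ℕ.+ m))))
        where
        a b : ℕ
        a = 1 ℕ.+ m ℕ.* 2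
        b = 2 ℕ.+ m ℕ.* 3
        p₂ : ∀ m → 5 ℕ.+ m ℕ.* 6 ≡ suc ((2 ℕ.+ m ℕ.* 3) ℕ.* 2)
        p₂ = ℕ.solve-∀
        sum₁ : ∀ m → m ℕ.+ suc (1 ℕ.+ m ℕ.* 2 ℕ.+ suc (1 ℕ.+ m ℕ.* 2) ℕ.+ m) ≡ 4 ℕ.+ m ℕ.* 6
        sum₁ = ℕ.solve-∀
        sum₂ : ∀ m → (1 ℕ.+ m ℕ.* 2) ℕ.+ (1 ℕ.+ m ℕ.* 2 ℕ.+ suc (1 ℕ.+ m ℕ.* 2)) ≡ 4 ℕ.+ m ℕ.* 6
        sum₂ = ℕ.solve-∀
        sum₃ : ∀ m → (1 ℕ.+ m ℕ.* 2) ℕ.+ suc (2 ℕ.+ m ℕ.* 3 ℕ.+ m) ≡ 4 ℕ.+ m ℕ.* 6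
        sum₃ = ℕ.solve-∀
        sum₄ : ∀ m → suc (1 ℕ.+ m ℕ.* 2 ℕ.+ m) ≡ 2 ℕ.+ m ℕ.* 3
        sum₄ = ℕ.solve-∀
        identity : ∀ h q xₘ xₐ xᵦ y₁ y₂ y₃ y₄ → + 3 * (+ 2 * h - - q) ≡
          + 2 * (+ 3 * h - ((y₁ - y₂) - (y₄ - xₐ))) + 1ℤ * (+ 3 * q - - (+ 2 * xₐ))
          + (- + 2) * (+ 2 * xₐ - (xₘ + (y₃ - xᵦ))) + (- + 2) * (xₘ - y₁) + + 2 * (xₐ - y₂) + + 2 * (xₐ - y₃)
          + (- + 2) * (y₄ - xᵦ)
        identity = solve-∀

-- From integer congruences to p-integral rationals.

module Rationals where

  open import Data.Nat as ℕ using (ℕ; suc)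
  import Data.Nat.Properties as ℕ
  import Data.Nat.Divisibility as ℕ
  import Data.Nat.DivMod as ℕ
  import Data.Nat.GCD as ℕ
  import Data.Nat.Tactic.RingSolver as ℕ
  open import Data.Nat.Primality using (Prime; prime⇒nonZero)
  open import Data.Integer as ℤ using (ℤ; +_)
  import Data.Integer.Properties as ℤ
  import Data.Integer.Tactic.RingSolver as ℤ
  open import Data.Integer.Divisibility.Signed using (divides)
  open import Data.Rational using (ℚ; _/_; _+_; _*_; _-_; -_; 0ℚ; 1ℚ; ½; toℚᵘ; ↧_; ↧ₙ_)
  open import Data.Rational.Properties using (toℚᵘ-injective; toℚᵘ-fromℚᵘ; toℚᵘ-homo-+; toℚᵘ-homo-*; fromℚᵘ-cong; neg-distribˡ-*; neg-distribʳ-*; *-assoc; *-comm; *-identityˡ; *-zeroʳ; *-distribˡ-+; +-identityˡ; ↧-/)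
  open import Data.Rational.Unnormalised as ℚᵘ using (mkℚᵘ; *≡*; _≃_)
  import Data.Rational.Unnormalised.Properties as ℚᵘ
  open import Data.Product using (_,_)
  open import Relation.Binary.PropositionalEquality hiding ([_])
  open TrinomialResidues

  ι : ℤ → ℚ
  ι i = i / 1

  toℚᵘ-ι : ∀ i → toℚᵘ (ι i) ≃ mkℚᵘ i 0
  toℚᵘ-ι i = toℚᵘ-fromℚᵘ (mkℚᵘ i 0)

  ι-+ : ∀ i j → ι (i ℤ.+ j) ≡ ι i + ι j
  ι-+ i j = toℚᵘ-injective (ℚᵘ.≃-trans (toℚᵘ-ι (i ℤ.+ j)) (ℚᵘ.≃-trans (*≡* (identity i j))
    (ℚᵘ.≃-trans (ℚᵘ.≃-sym (ℚᵘ.+-cong (toℚᵘ-ι i) (toℚᵘ-ι j))) (ℚᵘ.≃-sym (toℚᵘ-homo-+ (ι i) (ι j))))))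
    where
    identity : ∀ i j → (i ℤ.+ j) ℤ.* (+ 1) ≡ (i ℤ.* (+ 1) ℤ.+ j ℤ.* (+ 1)) ℤ.* (+ 1)
    identity = ℤ.solve-∀

  ι-* : ∀ i j → ι (i ℤ.* j) ≡ ι i * ι j
  ι-* i j = toℚᵘ-injective (ℚᵘ.≃-trans (toℚᵘ-ι (i ℤ.* j))
    (ℚᵘ.≃-trans (ℚᵘ.≃-sym (ℚᵘ.*-cong (toℚᵘ-ι i) (toℚᵘ-ι j))) (ℚᵘ.≃-sym (toℚᵘ-homo-* (ι i) (ι j)))))

  ι-neg : ∀ i → ι (ℤ.- i) ≡ - ι i
  ι-neg i = trans (cong ι (identity i)) (trans (ι-* (ℤ.- (+ 1)) i) (sym (neg-distribˡ-1 (ι i))))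
    where
    identity : ∀ i → ℤ.- i ≡ ℤ.- (+ 1) ℤ.* i
    identity = ℤ.solve-∀
    neg-distribˡ-1 : ∀ x → - x ≡ - 1ℚ * x
    neg-distribˡ-1 x = trans (cong -_ (sym (*-identityˡ x))) (neg-distribˡ-* 1ℚ x)

  *-exchange : ∀ x y z → x * (y * z) ≡ y * (x * z)
  *-exchange x y z = trans (sym (*-assoc x y z)) (trans (cong (_* z) (*-comm x y)) (*-assoc y x z))

  2*[½*x] : ∀ x → ι (+ 2) * (½ * x) ≡ x
  2*[½*x] x = trans (sym (*-assoc (ι (+ 2)) ½ x)) (*-identityˡ x)

  ½*[2*x] : ∀ x → ½ * (ι (+ 2) * x) ≡ x
  ½*[2*x] x = trans (sym (*-assoc ½ (ι (+ 2)) x)) (*-identityˡ x)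

  /2≡½* : ∀ z → z / 2 ≡ ½ * ι z
  /2≡½* z = toℚᵘ-injective (ℚᵘ.≃-trans (toℚᵘ-fromℚᵘ (mkℚᵘ z 1)) (ℚᵘ.≃-trans (*≡* (identity z))
    (ℚᵘ.≃-trans (ℚᵘ.≃-sym (ℚᵘ.*-cong (ℚᵘ.≃-refl {toℚᵘ ½}) (toℚᵘ-ι z))) (ℚᵘ.≃-sym (toℚᵘ-homo-* ½ (ι z))))))
    where
    identity : ∀ z → z ℤ.* (+ 2) ≡ (+ 1 ℤ.* z) ℤ.* (+ 2)
    identity = ℤ.solve-∀

  module _ (p : ℕ) (p-prime : Prime p) where
    open ModPrime p p-prime

    fermatQuotient≡ : ∀ a q → FermatQuotient a q → fermatQuotient p a ≡ ι q
    -- `fermatQuotient` reduces only at a successor, so p is generalised before matching.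
    fermatQuotient≡ a q = helper p {{prime⇒nonZero p-prime}}
      where
      helper : ∀ p .{{_ : ℕ.NonZero p}} → + (a ℕ.^ (p ℕ.∸ 1)) ℤ.- + 1 ≡ q ℤ.* + p → fermatQuotient p a ≡ ι q
      helper (suc p) eq = fromℚᵘ-cong {mkℚᵘ (+ (a ℕ.^ p) ℤ.- + 1) p} {mkℚᵘ q 0} (*≡* (trans (ℤ.*-identityʳ _) eq))

    ι-residue : ∀ n c z → ι (+ 2 ℤ.* c ℤ.+ + n ℤ.* P ℤ.* z) ≡ ι (+ 2) * ι c + ℕ→ℚ (n ℕ.* p) * ι z
    ι-residue n c z = trans (ι-+ (+ 2 ℤ.* c) (+ n ℤ.* P ℤ.* z)) (cong₂ _+_ (ι-* (+ 2) c)
      (trans (ι-* (+ n ℤ.* P) z) (cong (λ t → ι t * ι z) (sym (ℤ.pos-* n p)))))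

    -- By `↧-/`, the reduced denominator times gcd(z, 2) is 2, so a prime dividing the denominator
    -- divides 2.
    ↧-/2 : Unit 2 → ∀ z → Unit (↧ₙ (z / 2))
    ↧-/2 2-unit z p∣↧ = 2-unit (ℕ.∣-trans p∣↧ (ℕ.divides ∣gcd∣ (sym (trans (ℕ.*-comm ∣gcd∣ (↧ₙ (z / 2)))
      (ℤ.+-injective (trans (ℤ.pos-* (↧ₙ (z / 2)) ∣gcd∣) (↧-/ z 2)))))))
      where
      ∣gcd∣ = ℕ.gcd ℤ.∣ z ∣ 2

    -- Doubling turns both sides into integers, also where the residue involves ½.
    CongMod-double : Unit 2 → ∀ t y Y → + 2 ℤ.* + t ≈ Y [ P² ] → ι (+ 2) * y ≡ ι Y → CongMod p (p ℕ.^ 2) (ℕ→ℚ t) y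
    CongMod-double 2-unit t y Y (divides z eq) y≡Y = z / 2 , ↧-/2 2-unit z , (begin
      ι (+ t) - y                                   ≡⟨ double (ι (+ t)) y ⟩
      ½ * (ι (+ 2) * ι (+ t) + - (ι (+ 2) * y))     ≡⟨ cong₂ (λ v w → ½ * (v + - w)) (sym (ι-* (+ 2) (+ t))) y≡Y ⟩
      ½ * (ι (+ 2 ℤ.* + t) + - ι Y)                 ≡⟨ cong (λ v → ½ * (ι (+ 2 ℤ.* + t) + v)) (sym (ι-neg Y)) ⟩
      ½ * (ι (+ 2 ℤ.* + t) + ι (ℤ.- Y))             ≡⟨ cong (½ *_) (sym (ι-+ (+ 2 ℤ.* + t) (ℤ.- Y))) ⟩
      ½ * ι (+ 2 ℤ.* + t ℤ.- Y)                     ≡⟨ cong (λ v → ½ * ι v) eq ⟩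
      ½ * ι (z ℤ.* P²)                              ≡⟨ cong (½ *_) (ι-* z P²) ⟩
      ½ * (ι z * ι P²)                              ≡⟨ swap (ι z) (ι P²) ⟩
      ι P² * (½ * ι z)                              ≡⟨ cong₂ _*_ (cong ι P²≡) (sym (/2≡½* z)) ⟩
      ℕ→ℚ (p ℕ.^ 2) * (z / 2)                       ∎)
      where
      open ≡-Reasoning
      P²≡ : P² ≡ + (p ℕ.^ 2)
      P²≡ = trans (sym (ℤ.pos-* p p)) (cong (λ t → + (p ℕ.* t)) (sym (ℕ.*-identityʳ p)))
      double : ∀ x y → x - y ≡ ½ * (ι (+ 2) * x + - (ι (+ 2) * y))
      double x y = sym (trans (cong (½ *_) (trans (cong (λ v → ι (+ 2) * x + v) (neg-distribʳ-* (ι (+ 2)) y))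
        (sym (*-distribˡ-+ (ι (+ 2)) x (- y))))) (½*[2*x] (x - y)))
      swap : ∀ x y → ½ * (x * y) ≡ y * (½ * x)
      swap x y = trans (cong (½ *_) (*-comm x y)) (*-exchange ½ y x)

    n*p∸1 : ∀ n → 1 ℕ.≤ n → + (n ℕ.* p ℕ.∸ 1) ≡ + n ℤ.* P ℤ.- + 1
    n*p∸1 n 1≤n = trans (identity (+ (n ℕ.* p ℕ.∸ 1)))
      (cong (ℤ._- + 1) (trans (cong +_ (ℕ.m+[n∸m]≡n 1≤np)) (ℤ.pos-* n p)))
      where
      1≤np : 1 ℕ.≤ n ℕ.* p
      1≤np = ℕ.*-mono-≤ 1≤n (ℕ.>-nonZero⁻¹ p {{prime⇒nonZero p-prime}})
      identity : ∀ x → x ≡ (+ 1 ℤ.+ x) ℤ.- + 1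
      identity = ℤ.solve-∀

    -- The common last step of the four cases, which supply the value of C, the residue of 2 h and
    -- the doubled right-hand side. The coefficient of index k sits at the shifted index k + 1.
    trinomialCoeff-CongMod : Unit 2 → ∀ n k c z y → 1 ℕ.≤ n → suc k ℕ.≤ p → C (suc k) ≡ c → + 2 ℤ.* h (suc k) ≈ z [ P ] →
      ι (+ 2) * y ≡ ι (+ 2) * ι c + ℕ→ℚ (n ℕ.* p) * ι z →
      CongMod p (p ℕ.^ 2) (ℕ→ℚ (trinomialCoeff (n ℕ.* p ℕ.∸ 1) k)) y
    trinomialCoeff-CongMod 2-unit n k c z y 1≤n k<p refl h≈z y≡ =
      CongMod-double 2-unit (trinomialCoeff (n ℕ.* p ℕ.∸ 1) k) y (+ 2 ℤ.* c ℤ.+ + n ℤ.* P ℤ.* z)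
        (T-lift (n ℕ.* p ℕ.∸ 1) (+ n) (suc k) z (n*p∸1 n 1≤n) k<p h≈z) (trans y≡ (sym (ι-residue n c z)))

    module Cases (2-unit : Unit 2) (3-unit : Unit 3) (n : ℕ) (1≤n : 1 ℕ.≤ n) where

      private
        N : ℚ
        N = ℕ→ℚ (n ℕ.* p)

      at-p-1₁ : ∀ m → p ≡ suc (m ℕ.* 3) →
        CongMod p (p ℕ.^ 2) (ℕ→ℚ (trinomialCoeff (n ℕ.* p ℕ.∸ 1) (p ℕ.∸ 1))) (1ℚ + N * fermatQuotient p 3)
      at-p-1₁ m eq = let q , fq , h≈ = h-at-p-1₁ 2-unit 3-unit m eq in
        subst (λ k → CongMod p (p ℕ.^ 2) (ℕ→ℚ (trinomialCoeff (n ℕ.* p ℕ.∸ 1) k)) (1ℚ + N * fermatQuotient p 3))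
          (sym (cong (ℕ._∸ 1) eq))
          (trinomialCoeff-CongMod 2-unit n (m ℕ.* 3) (+ 1) (+ 2 ℤ.* q) (1ℚ + N * fermatQuotient p 3) 1≤n (ℕ.≤-reflexive (sym eq)) (C-1 m) h≈
            (trans (cong (λ t → ι (+ 2) * (1ℚ + N * t)) (fermatQuotient≡ 3 q fq)) (trans (identity N (ι q))
              (cong (λ t → ι (+ 2) * 1ℚ + N * t) (sym (ι-* (+ 2) q))))))
        where
        identity : ∀ N q → ι (+ 2) * (1ℚ + N * q) ≡ ι (+ 2) * 1ℚ + N * (ι (+ 2) * q)
        identity N q = trans (*-distribˡ-+ (ι (+ 2)) 1ℚ (N * q)) (cong (λ t → ι (+ 2) * 1ℚ + t) (*-exchange (ι (+ 2)) N q))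

      at-p-1₂ : ∀ m → p ≡ suc (suc (m ℕ.* 3)) →
        CongMod p (p ℕ.^ 2) (ℕ→ℚ (trinomialCoeff (n ℕ.* p ℕ.∸ 1) (p ℕ.∸ 1))) (- 1ℚ - N * fermatQuotient p 3)
      at-p-1₂ m eq = let q , fq , h≈ = h-at-p-1₂ 2-unit 3-unit m eq in
        subst (λ k → CongMod p (p ℕ.^ 2) (ℕ→ℚ (trinomialCoeff (n ℕ.* p ℕ.∸ 1) k)) (- 1ℚ - N * fermatQuotient p 3))
          (sym (cong (ℕ._∸ 1) eq))
          -- The shifted index is p = 3 m + 2, where C is -1.
          (trinomialCoeff-CongMod 2-unit n (suc (m ℕ.* 3)) (ℤ.- + 1) (ℤ.- (+ 2 ℤ.* q)) (- 1ℚ - N * fermatQuotient p 3) 1≤n (ℕ.≤-reflexive (sym eq)) (C-2 m) h≈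
            (trans (cong (λ t → ι (+ 2) * (- 1ℚ - N * t)) (fermatQuotient≡ 3 q fq)) (trans (identity N (ι q))
              (cong (λ t → ι (+ 2) * (- 1ℚ) + N * t) (sym (trans (ι-neg (+ 2 ℤ.* q)) (cong -_ (ι-* (+ 2) q))))))))
        where
        identity : ∀ N q → ι (+ 2) * (- 1ℚ - N * q) ≡ ι (+ 2) * (- 1ℚ) + N * (- (ι (+ 2) * q))
        identity N q = trans (*-distribˡ-+ (ι (+ 2)) (- 1ℚ) (- (N * q))) (cong (λ t → ι (+ 2) * (- 1ℚ) + t)
          (trans (cong (ι (+ 2) *_) (neg-distribʳ-* N q)) (trans (*-exchange (ι (+ 2)) N (- q))
            (cong (N *_) (sym (neg-distribʳ-* (ι (+ 2)) q))))))

      at-half₁ : ∀ m → p ≡ suc (m ℕ.* 6) →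
        CongMod p (p ℕ.^ 2) (ℕ→ℚ (trinomialCoeff (n ℕ.* p ℕ.∸ 1) ((p ℕ.∸ 1) ℕ./ 2)))
          (1ℚ + N * (ℕ→ℚ 2 * fermatQuotient p 2 + ½ * fermatQuotient p 3))
      at-half₁ m eq = let q₂ , q₃ , fq₂ , fq₃ , h≈ = h-at-half₁ 2-unit 3-unit m eq in
        subst (λ k → CongMod p (p ℕ.^ 2) (ℕ→ℚ (trinomialCoeff (n ℕ.* p ℕ.∸ 1) k))
            (1ℚ + N * (ℕ→ℚ 2 * fermatQuotient p 2 + ½ * fermatQuotient p 3)))
          (sym (trans (cong (λ t → (t ℕ.∸ 1) ℕ./ 2) eq) (trans (cong (ℕ._/ 2) (sym (ℕ.*-assoc m 3 2))) (ℕ.m*n/n≡m (m ℕ.* 3) 2))))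
          (trinomialCoeff-CongMod 2-unit n (m ℕ.* 3) (+ 1) (+ 4 ℤ.* q₂ ℤ.+ q₃) (1ℚ + N * (ℕ→ℚ 2 * fermatQuotient p 2 + ½ * fermatQuotient p 3)) 1≤n bound (C-1 m) h≈
            (trans (cong₂ (λ s t → ι (+ 2) * (1ℚ + N * (ι (+ 2) * s + ½ * t))) (fermatQuotient≡ 2 q₂ fq₂) (fermatQuotient≡ 3 q₃ fq₃))
              (trans (identity N (ι q₂) (ι q₃)) (cong (λ t → ι (+ 2) * 1ℚ + N * t)
                (sym (trans (ι-+ (+ 4 ℤ.* q₂) q₃) (cong (_+ ι q₃) (ι-* (+ 4) q₂))))))))
        where
        bound : suc (m ℕ.* 3) ℕ.≤ p
        bound = subst (suc (m ℕ.* 3) ℕ.≤_) (sym eq) (ℕ.s≤s (ℕ.*-monoʳ-≤ m (ℕ.m≤m+n 3 3)))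
        identity : ∀ N q₂ q₃ → ι (+ 2) * (1ℚ + N * (ι (+ 2) * q₂ + ½ * q₃)) ≡ ι (+ 2) * 1ℚ + N * (ι (+ 4) * q₂ + q₃)
        identity N q₂ q₃ = trans (*-distribˡ-+ (ι (+ 2)) 1ℚ (N * (ι (+ 2) * q₂ + ½ * q₃))) (cong (λ t → ι (+ 2) * 1ℚ + t)
          (trans (*-exchange (ι (+ 2)) N (ι (+ 2) * q₂ + ½ * q₃)) (cong (N *_)
            (trans (*-distribˡ-+ (ι (+ 2)) (ι (+ 2) * q₂) (½ * q₃))
              (cong₂ _+_ (sym (*-assoc (ι (+ 2)) (ι (+ 2)) q₂)) (2*[½*x] q₃))))))

      at-half₅ : ∀ m → p ≡ 5 ℕ.+ m ℕ.* 6 →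
        CongMod p (p ℕ.^ 2) (ℕ→ℚ (trinomialCoeff (n ℕ.* p ℕ.∸ 1) ((p ℕ.∸ 1) ℕ./ 2))) (- (½ * N * fermatQuotient p 3))
      at-half₅ m eq = let q₃ , fq₃ , h≈ = h-at-half₅ 2-unit 3-unit m eq in
        subst (λ k → CongMod p (p ℕ.^ 2) (ℕ→ℚ (trinomialCoeff (n ℕ.* p ℕ.∸ 1) k)) (- (½ * N * fermatQuotient p 3)))
          (sym (trans (cong (λ t → (t ℕ.∸ 1) ℕ./ 2) eq) (trans (cong (ℕ._/ 2) (half m)) (ℕ.m*n/n≡m (2 ℕ.+ m ℕ.* 3) 2))))
          -- The shifted index 3 m + 3 is a multiple of 3, so the leading term vanishes.
          (trinomialCoeff-CongMod 2-unit n (2 ℕ.+ m ℕ.* 3) (+ 0) (ℤ.- q₃) (- (½ * N * fermatQuotient p 3)) 1≤n bound (C-0 (suc m)) h≈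
            (trans (cong (λ t → ι (+ 2) * (- (½ * N * t))) (fermatQuotient≡ 3 q₃ fq₃))
              (trans (identity N (ι q₃)) (cong (λ t → ι (+ 2) * 0ℚ + N * t) (sym (ι-neg q₃))))))
        where
        half : ∀ m → 4 ℕ.+ m ℕ.* 6 ≡ (2 ℕ.+ m ℕ.* 3) ℕ.* 2
        half = ℕ.solve-∀
        bound : 3 ℕ.+ m ℕ.* 3 ℕ.≤ p
        bound = subst (3 ℕ.+ m ℕ.* 3 ℕ.≤_) (sym eq) (ℕ.+-mono-≤ (ℕ.m≤m+n 3 2) (ℕ.*-monoʳ-≤ m (ℕ.m≤m+n 3 3)))
        identity : ∀ N q → ι (+ 2) * (- (½ * N * q)) ≡ ι (+ 2) * 0ℚ + N * (- q)
        identity N q = trans (cong (ι (+ 2) *_) (trans (cong -_ (*-assoc ½ N q)) (neg-distribʳ-* ½ (N * q))))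
          (trans (2*[½*x] (- (N * q))) (trans (neg-distribʳ-* N q)
            (trans (sym (+-identityˡ (N * - q))) (cong (_+ N * - q) (sym (*-zeroʳ (ι (+ 2))))))))

-- The four residue cases assembled.

open import Data.Nat using (ℕ; _*_; _∸_; _/_; _%_; _^_; _≥_; _≤_)
open import Data.Nat.Primality using (Prime)
open import Data.Product using (_×_)
open import Relation.Binary.PropositionalEquality using (_≡_)
open import Data.Rational as ℚ using (ℚ; 1ℚ; ½; _+_; -_)

import Data.Nat as ℕ
import Data.Nat.Properties as ℕ
open import Data.Nat.DivMod using (m≡m%n+[m/n]*n)
open import Data.Product using (_,_)
open import Relation.Binary.PropositionalEquality using (trans; cong)

theorem1 : (p n : ℕ) → Prime p → p ≥ 5 → 1 ≤ n →
    ((p % 3 ≡ 1 → CongMod p (p ^ 2) (ℕ→ℚ (trinomialCoeff (n * p ∸ 1) (p ∸ 1)))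
    (1ℚ + ℕ→ℚ (n * p) ℚ.* fermatQuotient p 3))
    × (p % 3 ≡ 2 → CongMod p (p ^ 2) (ℕ→ℚ (trinomialCoeff (n * p ∸ 1) (p ∸ 1)))
    (- 1ℚ ℚ.- ℕ→ℚ (n * p) ℚ.* fermatQuotient p 3)))
    × ((p % 6 ≡ 1 → CongMod p (p ^ 2) (ℕ→ℚ (trinomialCoeff (n * p ∸ 1) ((p ∸ 1) / 2)))
    (1ℚ + ℕ→ℚ (n * p) ℚ.* (ℕ→ℚ 2 ℚ.* fermatQuotient p 2 + ½ ℚ.* fermatQuotient p 3)))
    × (p % 6 ≡ 5 → CongMod p (p ^ 2) (ℕ→ℚ (trinomialCoeff (n * p ∸ 1) ((p ∸ 1) / 2)))
    (- (½ ℚ.* ℕ→ℚ (n * p) ℚ.* fermatQuotient p 3))))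
theorem1 p n p-prime p≥5 1≤n =
  ( (λ r → at-p-1₁ (p / 3) (quotient-form 3 r))
  , (λ r → at-p-1₂ (p / 3) (quotient-form 3 r)))
  , (λ r → at-half₁ (p / 6) (quotient-form 6 r))
  , (λ r → at-half₅ (p / 6) (quotient-form 6 r))
  where
  open TrinomialResidues.ModPrime p p-prime using (Unit; <⇒Unit)
  2-unit : Unit 2
  2-unit = <⇒Unit (ℕ.≤-trans (ℕ.m≤m+n 3 2) p≥5)
  3-unit : Unit 3
  3-unit = <⇒Unit (ℕ.≤-trans (ℕ.m≤m+n 4 1) p≥5)
  open Rationals.Cases p p-prime 2-unit 3-unit n 1≤n
  -- For a literal r the right side reduces to the successor form that the four cases expect, with m
  -- = p / d.
  quotient-form : ∀ d .{{_ : ℕ.NonZero d}} {r} → p % d ≡ r → p ≡ r ℕ.+ p / d * d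
  quotient-form d eq = trans (m≡m%n+[m/n]*n p d) (cong (ℕ._+ p / d * d) eq)
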